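{- For all integers $r \geq 3$, $s \geq 3$, $t \geq 1$ and every real $\epsilon > 0$, there exists $m_0$ such that the following holds. If $m \geq m_0$ and $G$ is a graph with $m$ edges such that \[ \kappa_s(G) \geq \mathrm{mex}_{K_s}(m, K_{r+1}) + \epsilon m^{s/2}, \] then $G$ contains $K_{r+1}[t]$ as a subgraph.
   Context: All graphs are finite and simple. For a graph $G$, $\kappa_s(G)$ denotes the number of copies of the complete graph $K_s$ in $G$ (i.e. the number of $s$-cliques). For graphs $T$ and $F$, $\mathrm{mex}_T(m,F)$ is the maximum number of copies of $T$ in an $F$-free graph with exactly $m$ edges, where no restriction is placed on the number of vertices. For a graph $H$ and positive integer $t$, $H[t]$ is the $t$-fold blowup of $H$: every vertex of $H$ is replaced by an independent set of size $t$ and every edge by a complete bipartite graph $K_{t,t}$ between the corresponding sets. -}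

module Defs where

open import Data.Nat using (ℕ; zero; suc; _+_; _*_)
open import Data.Bool using (Bool; true; false; _∧_; if_then_else_)
open import Data.Fin using (Fin; quotient)
open import Data.Fin.Properties using ()
open import Data.List using (List; []; _∷_; map; _++_; allFin; [_])
open import Data.Bool.ListAction using (all)
open import Data.Nat.ListAction using (sum)
open import Data.Product using (Σ; _×_; _,_; ∃-syntax)
open import Relation.Binary.PropositionalEquality using (_≡_; _≢_)
open import Relation.Nullary using (¬_)
open import Function.Definitions using (Injective)
import Data.Fin
import Data.Empty
import Relation.Nullary
import Relation.Binary.PropositionalEquality
import Data.Nat

record Graph : Set where
  field
    n      : ℕ
    adj    : Fin n → Fin n → Bool
    sym    : ∀ i j → adj i j ≡ adj j i
    irrefl : ∀ i → adj i i ≡ false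
open Graph public

subsetsOf : {A : Set} → ℕ → List A → List (List A)
subsetsOf zero    xs       = [ [] ]
subsetsOf (suc k) []       = []
subsetsOf (suc k) (x ∷ xs) = map (x ∷_) (subsetsOf k xs) ++ subsetsOf (suc k) xs

isCliqueB : (G : Graph) → List (Fin (n G)) → Bool
isCliqueB G []       = true
isCliqueB G (x ∷ xs) = all (adj G x) xs ∧ isCliqueB G xs

κ : ℕ → Graph → ℕ
κ s G = sum (map (λ c → if isCliqueB G c then 1 else 0) (subsetsOf s (allFin (n G))))

edges : Graph → ℕ
edges G = κ 2 G

Contains : Graph → Graph → Set
Contains G H = Σ (Fin (n H) → Fin (n G)) λ f →
  Injective _≡_ _≡_ f × (∀ i j → adj H i j ≡ true → adj G (f i) (f j) ≡ true)

complete : ℕ → Graph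
complete k = record
  { n = k
  ; adj = adjK
  ; sym = symK
  ; irrefl = irreflK
  }
  where
  adjK : Fin k → Fin k → Bool
  adjK i j with Data.Fin._≟_ i j
  ... | Relation.Nullary.yes _ = false
  ... | Relation.Nullary.no  _ = true
  symK : ∀ i j → adjK i j ≡ adjK j i
  symK i j with Data.Fin._≟_ i j | Data.Fin._≟_ j i
  ... | Relation.Nullary.yes _ | Relation.Nullary.yes _ = Relation.Binary.PropositionalEquality.refl
  ... | Relation.Nullary.no  _ | Relation.Nullary.no  _ = Relation.Binary.PropositionalEquality.refl
  ... | Relation.Nullary.yes p | Relation.Nullary.no ¬q = Data.Empty.⊥-elim (¬q (Relation.Binary.PropositionalEquality.sym p))
  ... | Relation.Nullary.no ¬p | Relation.Nullary.yes q = Data.Empty.⊥-elim (¬p (Relation.Binary.PropositionalEquality.sym q))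
  irreflK : ∀ i → adjK i i ≡ false
  irreflK i with Data.Fin._≟_ i i
  ... | Relation.Nullary.yes _ = Relation.Binary.PropositionalEquality.refl
  ... | Relation.Nullary.no ¬p = Data.Empty.⊥-elim (¬p Relation.Binary.PropositionalEquality.refl)

-- the t-fold blowup H[t]: vertex x ∈ Fin (n H * t) lies in the class quotient t x of H
blowup : Graph → ℕ → Graph
blowup H t = record
  { n = n H * t
  ; adj = λ x y → adj H (quotient t x) (quotient t y)
  ; sym = λ x y → sym H (quotient t x) (quotient t y)
  ; irrefl = λ x → irrefl H (quotient t x)
  }

Free : Graph → Graph → Set
Free F G = ¬ Contains G F

-- IsMex T F m M : M = mex_T(m, F), the maximum of κ-count of T over F-free graphs with m edges.
-- Here T = K_s so we count copies via κ s.
IsMexK : (s : ℕ) → (F : Graph) → (m M : ℕ) → Set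
IsMexK s F m M =
  (∃[ H ] (Free F H × edges H ≡ m × κ s H ≡ M)) ×
  (∀ (H : Graph) → Free F H → edges H ≡ m → κ s H Data.Nat.≤ M)

{-# OPTIONS --safe #-}

-- Write h_s(L) for the number of s-tuples of entries of a list L of vertices that span a clique
-- (s! times the number of s-cliques of the graph pulled back along L).  Vertices of degree at most
-- √m/α lie in O(m^(s/2)/α^(s-2)) s-cliques, so they can be dropped; a list V of N = O(√m) vertices
-- remains.  If h_{r+1}(V) has order N^(r+1), Erdős's theorem yields K_{r+1}[t].  Otherwise a random
-- sample φ ∈ Vᵏ of constant length is K_{r+1}-free with high probability, its edge count is
-- concentrated by Chebyshev, and its expected s-clique density is that of V.  Blowing up a good sample by
-- a factor of about N/k gives a K_{r+1}-free graph with at most m edges (topped up to m by pendant edges)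
-- and almost as many s-cliques as G, which contradicts the excess over the maximum.

module Submission where

open import Defs hiding (sym)
open import Data.Nat using (ℕ; zero; suc; _+_; _*_; _^_; _∸_; _≤_; _<_; z≤n; s≤s; _!; >-nonZero; ≢-nonZero⁻¹)
open import Data.Integer using (∣_∣; +[1+_]; +0; -[1+_])
open import Data.Rational using (ℚ; mkℚ; ↥_; ↧ₙ_; Positive)
open import Data.Product using (Σ; ∃-syntax; _×_; _,_; proj₁; proj₂)
open import Relation.Binary.PropositionalEquality using (_≡_; _≢_; refl; sym; trans; cong; cong₂; subst; setoid; module ≡-Reasoning)
open import Data.Bool using (Bool; true; false; _∧_; if_then_else_)
open import Data.Bool.ListAction using (all)
open import Data.Bool.Properties using (∧-identityʳ; ∧-zeroʳ)
open import Data.Fin as Fin using (Fin; zero; suc; quotient; remainder; combine)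
open import Data.Fin.Properties using (combine-remQuot)
open import Data.List using (List; []; _∷_; map; _++_; length; concat; replicate; filter; tabulate; lookup; allFin; take; drop)
open import Data.List.Membership.Propositional using (_∈_)
open import Data.List.Membership.Propositional.Properties using (∈-lookup; ∈-allFin)
open import Data.List.Properties using (map-cong; map-++; map-tabulate; tabulate-lookup)
open import Data.List.Relation.Binary.Permutation.Propositional using (_↭_; ↭-refl; ↭-trans; prep; swap; ↭⇒↭ₛ)
open import Data.List.Relation.Binary.Permutation.Propositional.Properties using (map⁺; ↭-length; All-resp-↭)
import Data.List.Relation.Binary.Permutation.Setoid.Properties as SetoidPermutation
open import Data.List.Relation.Unary.All as All using (All; []; _∷_)
open import Data.List.Relation.Unary.AllPairs using ([]; _∷_)
open import Data.List.Relation.Unary.Any using (here; there)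
open import Data.List.Relation.Unary.Unique.Propositional using (Unique)
open import Data.List.Relation.Unary.Unique.Propositional.Properties using (allFin⁺; filter⁺)
open import Data.Nat.ListAction using (sum; product)
open import Data.Nat.ListAction.Properties using (sum-++; sum-↭)
open import Data.Nat.Properties
open import Data.Nat.Tactic.RingSolver using (solve-∀)
open import Data.Sum using (_⊎_; inj₁; inj₂; [_,_]′)
open import Function using (_∘_; id)
open import Function.Definitions using (Injective)
open import Level using (0ℓ)
open import Relation.Nullary using (¬_; Dec; yes; no; does; contradiction)
open import Relation.Unary using (Pred; Decidable)

-- The number of vertices of G is not bounded in terms of m, so clique densities carry no
-- information until N = O(√m); only then is an excess of order m^(s/2) a fixed share of N^s. A list
-- with few K_{r+1} is usually made K_{r+1}-free by the removal lemma. A sample of bounded length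
-- replaces it and needs only two moments. The delicate point is the edge budget: a sample rich in
-- s-cliques is useless if its blowup has more than m edges. Therefore the edge count of the sample
-- must not exceed its mean by much, and the blowup factor stays slightly below N/k, which leaves
-- room for the deviation. The estimates stay in ℕ: an expectation over Vᵏ is a sum that is compared
-- with N^k, a density 1/Θ is an inequality with the factor Θ, and a relative error 1/C is a summand
-- beside terms multiplied by C.

private variable
  A B : Set

-- Sums over tuples, with and without repetition of positions

∑ : List A → (A → ℕ) → ℕ
∑ xs f = sum (map f xs)

∑-cong : (xs : List A) {f g : A → ℕ} → (∀ x → f x ≡ g x) → ∑ xs f ≡ ∑ xs g
∑-cong xs f≗g = cong sum (map-cong f≗g xs)

∑-mono : (xs : List A) {f g : A → ℕ} → (∀ x → f x ≤ g x) → ∑ xs f ≤ ∑ xs g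
∑-mono []       f≤g = z≤n
∑-mono (x ∷ xs) f≤g = +-mono-≤ (f≤g x) (∑-mono xs f≤g)

∑-+ : (xs : List A) (f g : A → ℕ) → ∑ xs (λ x → f x + g x) ≡ ∑ xs f + ∑ xs g
∑-+ []       f g = refl
∑-+ (x ∷ xs) f g rewrite ∑-+ xs f g = interchange (f x) (g x) (∑ xs f) (∑ xs g)
  where
  interchange : ∀ a b c d → (a + b) + (c + d) ≡ (a + c) + (b + d)
  interchange = solve-∀

∑-*ˡ : (c : ℕ) (xs : List A) (f : A → ℕ) → ∑ xs (λ x → c * f x) ≡ c * ∑ xs f
∑-*ˡ c []       f = sym (*-zeroʳ c)
∑-*ˡ c (x ∷ xs) f rewrite ∑-*ˡ c xs f = sym (*-distribˡ-+ c (f x) _)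

∑-const : (xs : List A) (c : ℕ) → ∑ xs (λ _ → c) ≡ length xs * c
∑-const []       c = refl
∑-const (x ∷ xs) c = cong (c +_) (∑-const xs c)

∑-zero : (xs : List A) → ∑ xs (λ _ → 0) ≡ 0
∑-zero xs = trans (∑-const xs 0) (*-zeroʳ (length xs))

∑-swap : (xs : List A) (ys : List B) (f : A → B → ℕ) →
  ∑ xs (λ x → ∑ ys (λ y → f x y)) ≡ ∑ ys (λ y → ∑ xs (λ x → f x y))
∑-swap []       ys f = sym (∑-zero ys)
∑-swap (x ∷ xs) ys f rewrite ∑-swap xs ys f = sym (∑-+ ys (f x) _)

∑-++ : (xs ys : List A) (f : A → ℕ) → ∑ (xs ++ ys) f ≡ ∑ xs f + ∑ ys f
∑-++ xs ys f = trans (cong sum (map-++ f xs ys)) (sum-++ (map f xs) (map f ys))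

∑-↭ : {xs ys : List A} (f : A → ℕ) → xs ↭ ys → ∑ xs f ≡ ∑ ys f
∑-↭ f xs↭ys = sum-↭ (map⁺ f xs↭ys)

∑-map : (g : A → B) (xs : List A) (f : B → ℕ) → ∑ (map g xs) f ≡ ∑ xs (f ∘ g)
∑-map g []       f = refl
∑-map g (x ∷ xs) f = cong (f (g x) +_) (∑-map g xs f)

-- Divided by `length V ^ l`, this is the expectation of `F` over a uniformly random `l`-tuple;
-- probabilities appear below as such sums.
∑^ : ℕ → List A → (List A → ℕ) → ℕ
∑^ zero    V F = F []
∑^ (suc l) V F = ∑ V (λ x → ∑^ l V (F ∘ (x ∷_)))

∑^-cong : ∀ l (V : List A) {F G : List A → ℕ} → (∀ c → length c ≡ l → F c ≡ G c) → ∑^ l V F ≡ ∑^ l V G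
∑^-cong zero    V F≗G = F≗G [] refl
∑^-cong (suc l) V F≗G = ∑-cong V λ x → ∑^-cong l V λ c eq → F≗G (x ∷ c) (cong suc eq)

∑^-mono : ∀ l (V : List A) {F G : List A → ℕ} → (∀ c → length c ≡ l → F c ≤ G c) → ∑^ l V F ≤ ∑^ l V G
∑^-mono zero    V F≤G = F≤G [] refl
∑^-mono (suc l) V F≤G = ∑-mono V λ x → ∑^-mono l V λ c eq → F≤G (x ∷ c) (cong suc eq)

∑^-+ : ∀ l (V : List A) (F G : List A → ℕ) → ∑^ l V (λ c → F c + G c) ≡ ∑^ l V F + ∑^ l V G
∑^-+ zero    V F G = refl
∑^-+ (suc l) V F G = trans (∑-cong V λ x → ∑^-+ l V (F ∘ (x ∷_)) (G ∘ (x ∷_))) (∑-+ V _ _)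

∑^-*ˡ : ∀ k l (V : List A) (F : List A → ℕ) → ∑^ l V (λ c → k * F c) ≡ k * ∑^ l V F
∑^-*ˡ k zero    V F = refl
∑^-*ˡ k (suc l) V F = trans (∑-cong V λ x → ∑^-*ˡ k l V (F ∘ (x ∷_))) (∑-*ˡ k V _)

∑^-*ʳ : ∀ k l (V : List A) (F : List A → ℕ) → ∑^ l V (λ c → F c * k) ≡ ∑^ l V F * k
∑^-*ʳ k l V F = trans (∑^-cong l V λ c _ → *-comm (F c) k) (trans (∑^-*ˡ k l V F) (*-comm k _))

∑^-const : ∀ l (V : List A) (k : ℕ) → ∑^ l V (λ _ → k) ≡ length V ^ l * k
∑^-const zero    V k = sym (+-identityʳ k)
∑^-const (suc l) V k = begin
  ∑ V (λ _ → ∑^ l V (λ _ → k))       ≡⟨ ∑-cong V (λ _ → ∑^-const l V k) ⟩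
  ∑ V (λ _ → length V ^ l * k)       ≡⟨ ∑-const V _ ⟩
  length V * (length V ^ l * k)      ≡⟨ sym (*-assoc (length V) _ k) ⟩
  length V ^ suc l * k               ∎
  where open ≡-Reasoning

∑^-bound : ∀ l (V : List A) {F : List A → ℕ} {k} → (∀ c → length c ≡ l → F c ≤ k) → ∑^ l V F ≤ length V ^ l * k
∑^-bound l V {k = k} F≤k = ≤-trans (∑^-mono l V F≤k) (≤-reflexive (∑^-const l V k))

∑^-zero : ∀ l (V : List A) → ∑^ l V (λ _ → 0) ≡ 0
∑^-zero l V = trans (∑^-const l V 0) (*-zeroʳ (length V ^ l))

∑-∑^-swap : ∀ (xs : List B) l (V : List A) (f : B → List A → ℕ) →
  ∑ xs (λ x → ∑^ l V (f x)) ≡ ∑^ l V (λ c → ∑ xs (λ x → f x c))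
∑-∑^-swap xs zero    V f = refl
∑-∑^-swap xs (suc l) V f = trans (∑-swap xs V _) (∑-cong V λ y → ∑-∑^-swap xs l V (λ x → f x ∘ (y ∷_)))

∑^-swap : ∀ k (W : List B) l (V : List A) (F : List B → List A → ℕ) →
  ∑^ k W (λ d → ∑^ l V (F d)) ≡ ∑^ l V (λ c → ∑^ k W (λ d → F d c))
∑^-swap zero    W l V F = refl
∑^-swap (suc k) W l V F = trans (∑-cong W λ y → ∑^-swap k W l V (F ∘ (y ∷_))) (∑-∑^-swap W l V (λ y c → ∑^ k W (λ d → F (y ∷ d) c)))

∑^-↭ : ∀ l {V W : List A} (F : List A → ℕ) → V ↭ W → ∑^ l V F ≡ ∑^ l W F
∑^-↭ zero            F V↭W = refl
∑^-↭ (suc l) {W = W} F V↭W = trans (∑-↭ _ V↭W) (∑-cong W λ x → ∑^-↭ l (F ∘ (x ∷_)) V↭W)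

∑^-map : ∀ l (g : B → A) (V : List B) (F : List A → ℕ) → ∑^ l (map g V) F ≡ ∑^ l V (F ∘ map g)
∑^-map zero    g V F = refl
∑^-map (suc l) g V F = trans (∑-map g V _) (∑-cong V λ x → ∑^-map l g V _)

∑^-product : ∀ l (V : List A) (f : A → ℕ) → ∑^ l V (λ c → product (map f c)) ≡ ∑ V f ^ l
∑^-product zero    V f = refl
∑^-product (suc l) V f = begin
  ∑ V (λ x → ∑^ l V (λ c → f x * product (map f c)))  ≡⟨ ∑-cong V (λ x → trans (∑^-*ˡ (f x) l V (product ∘ map f)) (*-comm (f x) _)) ⟩
  ∑ V (λ x → ∑^ l V (λ c → product (map f c)) * f x)  ≡⟨ ∑-*ˡ (∑^ l V (product ∘ map f)) V f ⟩
  ∑^ l V (λ c → product (map f c)) * ∑ V f            ≡⟨ cong (_* ∑ V f) (∑^-product l V f) ⟩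
  ∑ V f ^ l * ∑ V f                                   ≡⟨ *-comm _ (∑ V f) ⟩
  ∑ V f ^ suc l                                       ∎
  where open ≡-Reasoning

copies : ℕ → List A → List A
copies q V = concat (replicate q V)

∑-copies : ∀ q (V : List A) (f : A → ℕ) → ∑ (copies q V) f ≡ q * ∑ V f
∑-copies zero    V f = refl
∑-copies (suc q) V f = trans (∑-++ V (copies q V) f) (cong (∑ V f +_) (∑-copies q V f))

∑^-copies : ∀ l q (V : List A) (F : List A → ℕ) → ∑^ l (copies q V) F ≡ q ^ l * ∑^ l V F
∑^-copies zero    q V F = sym (+-identityʳ _)
∑^-copies (suc l) q V F = begin
  ∑ (copies q V) (λ x → ∑^ l (copies q V) (F ∘ (x ∷_)))  ≡⟨ ∑-cong (copies q V) (λ x → ∑^-copies l q V _) ⟩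
  ∑ (copies q V) (λ x → q ^ l * ∑^ l V (F ∘ (x ∷_)))     ≡⟨ ∑-copies q V _ ⟩
  q * ∑ V (λ x → q ^ l * ∑^ l V (F ∘ (x ∷_)))            ≡⟨ cong (q *_) (∑-*ˡ (q ^ l) V _) ⟩
  q * (q ^ l * ∑^ (suc l) V F)                           ≡⟨ sym (*-assoc q _ _) ⟩
  q ^ suc l * ∑^ (suc l) V F                             ∎
  where open ≡-Reasoning

-- `g` also receives the rest of the list, so that nested picks use distinct positions.
∑pick : List A → (A → List A → ℕ) → ℕ
∑pick []      g = 0
∑pick (x ∷ V) g = g x V + ∑pick V (λ y V′ → g y (x ∷ V′))

∑pick-mono : (V : List A) {g g′ : A → List A → ℕ} →
  (∀ x V′ → V ↭ x ∷ V′ → g x V′ ≤ g′ x V′) → ∑pick V g ≤ ∑pick V g′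
∑pick-mono []      g≤g′ = z≤n
∑pick-mono (x ∷ V) g≤g′ = +-mono-≤ (g≤g′ x V ↭-refl)
  (∑pick-mono V λ y V′ V↭ → g≤g′ y (x ∷ V′) (↭-trans (prep x V↭) (swap x y ↭-refl)))

∑pick-cong : (V : List A) {g g′ : A → List A → ℕ} →
  (∀ x V′ → V ↭ x ∷ V′ → g x V′ ≡ g′ x V′) → ∑pick V g ≡ ∑pick V g′
∑pick-cong V g≗g′ = ≤-antisym (∑pick-mono V λ x V′ p → ≤-reflexive (g≗g′ x V′ p))
                              (∑pick-mono V λ x V′ p → ≤-reflexive (sym (g≗g′ x V′ p)))

∑pick-+ : (V : List A) (f g : A → List A → ℕ) → ∑pick V (λ x V′ → f x V′ + g x V′) ≡ ∑pick V f + ∑pick V g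
∑pick-+ []      f g = refl
∑pick-+ (x ∷ V) f g rewrite ∑pick-+ V (λ y V′ → f y (x ∷ V′)) (λ y V′ → g y (x ∷ V′)) =
  interchange (f x V) (g x V) _ _
  where
  interchange : ∀ a b c d → (a + b) + (c + d) ≡ (a + c) + (b + d)
  interchange = solve-∀

∑pick-*ˡ : (k : ℕ) (V : List A) (g : A → List A → ℕ) → ∑pick V (λ x V′ → k * g x V′) ≡ k * ∑pick V g
∑pick-*ˡ k []      g = sym (*-zeroʳ k)
∑pick-*ˡ k (x ∷ V) g rewrite ∑pick-*ˡ k V (λ y V′ → g y (x ∷ V′)) = sym (*-distribˡ-+ k (g x V) _)

∑pick-∑ : (V : List A) (f : A → ℕ) → ∑pick V (λ x _ → f x) ≡ ∑ V f
∑pick-∑ []      f = refl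
∑pick-∑ (x ∷ V) f = cong (f x +_) (∑pick-∑ V f)

∑pick-witness : ∀ (V : List A) g C → length V * C < ∑pick V g → ∃[ x ] ∃[ V′ ] (V ↭ x ∷ V′ × C < g x V′)
∑pick-witness []      g C ()
∑pick-witness (x ∷ V) g C lt with C <? g x V
... | yes C<g = x , V , ↭-refl , C<g
... | no  C≮g with ∑pick-witness V (λ y V′ → g y (x ∷ V′)) C (+-cancelˡ-< C _ _ (≤-trans lt (+-monoˡ-≤ _ (≮⇒≥ C≮g))))
... | y , V′ , V↭ , C<g = y , x ∷ V′ , ↭-trans (prep x V↭) (swap x y ↭-refl) , C<g

-- Removing any one of the `suc k` positions of a uniform tuple leaves an independent entry and a
-- uniform `k`-tuple. The induction splits off the first position; `∑-swap` shows that the others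
-- contribute the same double sum `S`.
∑^-∑pick : ∀ k (V : List A) (g : A → List A → ℕ) →
  ∑^ (suc k) V (λ φ → ∑pick φ g) ≡ suc k * ∑ V (λ x → ∑^ k V (g x))
∑^-∑pick zero    V g = trans (∑-cong V λ x → +-identityʳ _) (sym (+-identityʳ _))
∑^-∑pick (suc k) V g = begin
  ∑ V (λ x → ∑^ (suc k) V (λ φ → g x φ + ∑pick φ (λ y φ′ → g y (x ∷ φ′))))
    ≡⟨ ∑-cong V (λ x → ∑^-+ (suc k) V (g x) (λ φ → ∑pick φ (λ y φ′ → g y (x ∷ φ′)))) ⟩
  ∑ V (λ x → ∑^ (suc k) V (g x) + ∑^ (suc k) V (λ φ → ∑pick φ (λ y φ′ → g y (x ∷ φ′))))
    ≡⟨ ∑-+ V _ _ ⟩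
  S + ∑ V (λ x → ∑^ (suc k) V (λ φ → ∑pick φ (λ y φ′ → g y (x ∷ φ′))))
    ≡⟨ cong (S +_) (∑-cong V λ x → ∑^-∑pick k V _) ⟩
  S + ∑ V (λ x → suc k * ∑ V (λ y → ∑^ k V (λ φ′ → g y (x ∷ φ′))))
    ≡⟨ cong (S +_) (∑-*ˡ (suc k) V _) ⟩
  S + suc k * ∑ V (λ x → ∑ V (λ y → ∑^ k V (λ φ′ → g y (x ∷ φ′))))
    ≡⟨ cong (λ z → S + suc k * z) (∑-swap V V _) ⟩
  S + suc k * S ∎
  where
  open ≡-Reasoning
  S = ∑ V (λ x → ∑^ (suc k) V (g x))

-- Positions, not values, are distinct: an entry occurring twice in V can be used twice.
∑inj : ℕ → List A → (List A → ℕ) → ℕ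
∑inj zero    V F = F []
∑inj (suc l) V F = ∑pick V (λ x V′ → ∑inj l V′ (F ∘ (x ∷_)))

falling : ℕ → ℕ → ℕ
falling k       zero    = 1
falling zero    (suc l) = 0
falling (suc k) (suc l) = suc k * falling k l

falling≤^ : ∀ k l → falling k l ≤ k ^ l
falling≤^ k       zero    = ≤-refl
falling≤^ zero    (suc l) = z≤n
falling≤^ (suc k) (suc l) = *-monoʳ-≤ (suc k) (≤-trans (falling≤^ k l) (^-monoˡ-≤ l (n≤1+n k)))

-- Linearity of expectation for a random sample: each of the `falling k l` injective choices of
-- positions carries a uniform `l`-tuple. The factor `length V ^ l` on the left avoids the exponent
-- k - l.
∑^-∑inj : ∀ k l (V : List A) (F : List A → ℕ) →
  length V ^ l * ∑^ k V (λ φ → ∑inj l φ F) ≡ falling k l * (length V ^ k * ∑^ l V F)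
∑^-∑inj k       zero    V F rewrite ∑^-const k V (F []) = refl
∑^-∑inj zero    (suc l) V F = *-zeroʳ (length V ^ suc l)
∑^-∑inj (suc k) (suc l) V F = begin
  N * N ^ l * ∑^ (suc k) V (λ φ → ∑inj (suc l) φ F)
    ≡⟨ cong (N * N ^ l *_) (∑^-∑pick k V _) ⟩
  N * N ^ l * (suc k * ∑ V (λ x → ∑^ k V (λ φ → ∑inj l φ (F ∘ (x ∷_)))))
    ≡⟨ arrange₁ N (N ^ l) (suc k) _ ⟩
  suc k * N * (N ^ l * ∑ V (λ x → ∑^ k V (λ φ → ∑inj l φ (F ∘ (x ∷_)))))
    ≡⟨ cong (suc k * N *_) (sym (∑-*ˡ (N ^ l) V _)) ⟩
  suc k * N * ∑ V (λ x → N ^ l * ∑^ k V (λ φ → ∑inj l φ (F ∘ (x ∷_))))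
    ≡⟨ cong (suc k * N *_) (∑-cong V λ x → trans (∑^-∑inj k l V _) (sym (*-assoc (falling k l) (N ^ k) _))) ⟩
  suc k * N * ∑ V (λ x → falling k l * N ^ k * ∑^ l V (F ∘ (x ∷_)))
    ≡⟨ cong (suc k * N *_) (∑-*ˡ (falling k l * N ^ k) V _) ⟩
  suc k * N * (falling k l * N ^ k * ∑^ (suc l) V F)
    ≡⟨ arrange₂ (suc k) N (falling k l) (N ^ k) _ ⟩
  suc k * falling k l * (N * N ^ k * ∑^ (suc l) V F) ∎
  where
  open ≡-Reasoning
  N = length V
  arrange₁ : ∀ a b c d → a * b * (c * d) ≡ c * a * (b * d)
  arrange₁ = solve-∀
  arrange₂ : ∀ a b c d e → a * b * (c * d * e) ≡ a * c * (b * d * e)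
  arrange₂ = solve-∀

-- The difference comes from tuples that use the new entry: `suc l` coordinates can hold it, and the
-- remaining ones have `suc (length V) ^ l` values.
∑^-∷≤ : ∀ l x (V : List A) {F B} → (∀ c → F c ≤ B) →
  ∑^ (suc l) (x ∷ V) F ≤ ∑^ (suc l) V F + suc l * (suc (length V) ^ l * B)
∑^-∷≤ zero x V {F} {B} F≤B = begin
  F (x ∷ []) + S           ≤⟨ +-monoˡ-≤ S (F≤B _) ⟩
  B + S                    ≡⟨ arrange B S ⟩
  S + 1 * (1 * B)          ∎
  where
  open ≤-Reasoning
  S = ∑ V (λ y → F (y ∷ []))
  arrange : ∀ b s → b + s ≡ s + 1 * (1 * b)
  arrange = solve-∀
∑^-∷≤ (suc l) x V {F} {B} F≤B = begin
  ∑^ (suc l) (x ∷ V) (F ∘ (x ∷_)) + ∑ V (λ y → ∑^ (suc l) (x ∷ V) (F ∘ (y ∷_)))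
    ≤⟨ +-mono-≤ (∑^-bound (suc l) (x ∷ V) λ c _ → F≤B (x ∷ c)) (∑-mono V λ y → ∑^-∷≤ l x V λ c → F≤B (y ∷ c)) ⟩
  K * K ^ l * B + ∑ V (λ y → ∑^ (suc l) V (F ∘ (y ∷_)) + suc l * (K ^ l * B))
    ≡⟨ cong (K * K ^ l * B +_) (trans (∑-+ V _ _) (cong (S +_) (∑-const V _))) ⟩
  K * K ^ l * B + (S + length V * (suc l * (K ^ l * B)))
    ≤⟨ +-monoʳ-≤ (K * K ^ l * B) (+-monoʳ-≤ S (*-monoˡ-≤ _ (n≤1+n (length V)))) ⟩
  K * K ^ l * B + (S + K * (suc l * (K ^ l * B)))
    ≡⟨ arrange K (K ^ l) B S l ⟩
  S + suc (suc l) * (K ^ suc l * B) ∎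
  where
  open ≤-Reasoning
  K = suc (length V)
  S = ∑^ (suc (suc l)) V F
  arrange : ∀ k p b s l → k * p * b + (s + k * ((1 + l) * (p * b))) ≡ s + (2 + l) * (k * p * b)
  arrange = solve-∀

-- A union bound: only a share O(1/N) of the tuples repeats a position. The constant is rounded up
-- to a square so that the induction closes.
∑^≤∑inj : ∀ l (V : List A) {F B} → (∀ c → F c ≤ B) →
  ∑^ (suc l) V F ≤ ∑inj (suc l) V F + suc l * suc l * (length V ^ l * B)
∑^≤∑inj zero    V {F} F≤B = ≤-trans (≤-reflexive (sym (∑pick-∑ V _))) (m≤m+n _ _)
∑^≤∑inj (suc l) V {F} {B} F≤B = begin
  ∑ V (λ x → ∑^ (suc l) V (F ∘ (x ∷_)))
    ≡⟨ sym (∑pick-∑ V _) ⟩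
  ∑pick V (λ x _ → ∑^ (suc l) V (F ∘ (x ∷_)))
    ≤⟨ ∑pick-mono V step ⟩
  ∑pick V (λ x V′ → ∑inj (suc l) V′ (F ∘ (x ∷_)) + e)
    ≡⟨ ∑pick-+ V (λ x V′ → ∑inj (suc l) V′ (F ∘ (x ∷_))) (λ _ _ → e) ⟩
  S + ∑pick V (λ _ _ → e)
    ≡⟨ cong (S +_) (trans (∑pick-∑ V _) (∑-const V e)) ⟩
  S + N * ((suc l * suc l + suc l) * (N ^ l * B))
    ≤⟨ +-monoʳ-≤ S (≤-trans (m≤m+n _ ((2 + l) * (N * N ^ l * B))) (≤-reflexive (arrange N l (N ^ l) B))) ⟩
  S + suc (suc l) * suc (suc l) * (N ^ suc l * B) ∎
  where
  open ≤-Reasoning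
  N = length V
  S = ∑inj (suc (suc l)) V F
  -- `suc l * suc l` comes from the induction hypothesis, the further `suc l` from removing `x` by
  -- `∑^-∷≤`; another 2 + l completes the square (2 + l)².
  e = (suc l * suc l + suc l) * (N ^ l * B)
  arrange : ∀ n l p b → n * (((1 + l) * (1 + l) + (1 + l)) * (p * b)) + (2 + l) * (n * p * b) ≡ (2 + l) * (2 + l) * (n * p * b)
  arrange = solve-∀
  arrange′ : ∀ s l p → s + (1 + l) * (1 + l) * p + (1 + l) * p ≡ s + ((1 + l) * (1 + l) + (1 + l)) * p
  arrange′ = solve-∀
  step : ∀ x V′ → V ↭ x ∷ V′ → ∑^ (suc l) V (F ∘ (x ∷_)) ≤ ∑inj (suc l) V′ (F ∘ (x ∷_)) + e
  step x V′ p = begin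
    ∑^ (suc l) V G                                   ≡⟨ ∑^-↭ (suc l) G p ⟩
    ∑^ (suc l) (x ∷ V′) G                            ≤⟨ ∑^-∷≤ l x V′ (λ c → F≤B (x ∷ c)) ⟩
    ∑^ (suc l) V′ G + suc l * (suc N′ ^ l * B)       ≡⟨ cong (λ k → ∑^ (suc l) V′ G + suc l * (k ^ l * B)) (sym (↭-length p)) ⟩
    ∑^ (suc l) V′ G + suc l * (N ^ l * B)            ≤⟨ +-monoˡ-≤ _ (∑^≤∑inj l V′ λ c → F≤B (x ∷ c)) ⟩
    ∑inj (suc l) V′ G + suc l * suc l * (N′ ^ l * B) + suc l * (N ^ l * B)
      ≤⟨ +-monoˡ-≤ _ (+-monoʳ-≤ (∑inj (suc l) V′ G) (*-monoʳ-≤ (suc l * suc l) (*-monoˡ-≤ B (^-monoˡ-≤ l N′≤N)))) ⟩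
    ∑inj (suc l) V′ G + suc l * suc l * (N ^ l * B) + suc l * (N ^ l * B)
      ≡⟨ arrange′ (∑inj (suc l) V′ G) l (N ^ l * B) ⟩
    ∑inj (suc l) V′ G + e ∎
    where
    G = F ∘ (x ∷_)
    N′ = length V′
    N′≤N : N′ ≤ N
    N′≤N = ≤-trans (n≤1+n N′) (≤-reflexive (sym (↭-length p)))

∑^-∷-vanish : ∀ l x (V : List A) (F : List A → ℕ) → (∀ p c → F (p ++ x ∷ c) ≡ 0) → ∑^ l (x ∷ V) F ≡ ∑^ l V F
∑^-∷-vanish zero    x V F F≡0 = refl
∑^-∷-vanish (suc l) x V F F≡0 = cong₂ _+_
  (trans (∑^-cong l (x ∷ V) λ c _ → F≡0 [] c) (∑^-zero l (x ∷ V)))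
  (∑-cong V λ y → ∑^-∷-vanish l x V (F ∘ (y ∷_)) (λ p c → F≡0 (y ∷ p) c))

-- Choosing a position twice repeats its entry, so `rep≡0` kills every tuple by which the two sums
-- differ. For cliques this makes the passage exact, without the error term of `∑^≤∑inj`.
∑^≡∑inj : ∀ l (V : List A) (F : List A → ℕ) → (∀ p x q c → F (p ++ x ∷ q ++ x ∷ c) ≡ 0) → ∑^ l V F ≡ ∑inj l V F
∑^≡∑inj zero    V F rep≡0 = refl
∑^≡∑inj (suc l) V F rep≡0 = trans (sym (∑pick-∑ V _)) (∑pick-cong V λ x V′ V↭ → begin
  ∑^ l V (F ∘ (x ∷_))          ≡⟨ ∑^-↭ l (F ∘ (x ∷_)) V↭ ⟩
  ∑^ l (x ∷ V′) (F ∘ (x ∷_))   ≡⟨ ∑^-∷-vanish l x V′ (F ∘ (x ∷_)) (rep≡0 [] x) ⟩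
  ∑^ l V′ (F ∘ (x ∷_))         ≡⟨ ∑^≡∑inj l V′ (F ∘ (x ∷_)) (λ p → rep≡0 (x ∷ p)) ⟩
  ∑inj l V′ (F ∘ (x ∷_))       ∎)
  where open ≡-Reasoning

-- Clique counts and low-degree vertices

Unique-resp-↭ : {xs ys : List A} → xs ↭ ys → Unique xs → Unique ys
Unique-resp-↭ p = SetoidPermutation.Unique-resp-↭ (setoid _) (↭⇒↭ₛ p)

-- Averaging over at most `length V ^ l` terms. Transferring an arbitrary `All P` from `V` to `τ` is
-- what shows, in the induction, that the head of `τ` differs from its later entries.
∑inj-witness : ∀ l (V : List A) F C → length V ^ l * C < ∑inj l V F →
  ∃[ τ ] (length τ ≡ l × (∀ {P : Pred A 0ℓ} → All P V → All P τ) × (Unique V → Unique τ) × C < F τ)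
∑inj-witness zero    V F C lt = [] , refl , (λ _ → []) , (λ _ → []) , subst (_< F []) (+-identityʳ C) lt
∑inj-witness (suc l) V F C lt
  with x , V′ , V↭ , lt₁ ← ∑pick-witness V _ (length V ^ l * C) (subst (_< ∑inj (suc l) V F) (*-assoc (length V) _ C) lt)
  with τ , len , all-τ , uniq , C<F ← ∑inj-witness l V′ (F ∘ (x ∷_)) C
         (≤-<-trans (*-monoˡ-≤ C (^-monoˡ-≤ l (≤-trans (n≤1+n _) (≤-reflexive (sym (↭-length V↭)))))) lt₁)
  = x ∷ τ , cong suc len , (λ ps → cons (All-resp-↭ V↭ ps)) , (λ u → consᵘ (Unique-resp-↭ V↭ u)) , C<F
  where
  cons : ∀ {P : Pred _ 0ℓ} → All P (x ∷ V′) → All P (x ∷ τ)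
  cons (p ∷ ps) = p ∷ all-τ ps
  consᵘ : Unique (x ∷ V′) → Unique (x ∷ τ)
  consᵘ (x∉ ∷ u) = all-τ x∉ ∷ uniq u

∑sub : ℕ → List A → (List A → ℕ) → ℕ
∑sub s V F = ∑ (subsetsOf s V) F

∑sub-∷ : ∀ s x (V : List A) F → ∑sub (suc s) (x ∷ V) F ≡ ∑sub s V (F ∘ (x ∷_)) + ∑sub (suc s) V F
∑sub-∷ s x V F = trans (∑-++ (map (x ∷_) (subsetsOf s V)) _ F) (cong (_+ ∑sub (suc s) V F) (∑-map (x ∷_) (subsetsOf s V) F))

∑sub-cong : ∀ s (V : List A) {F G : List A → ℕ} → (∀ c → length c ≡ s → F c ≡ G c) → ∑sub s V F ≡ ∑sub s V G
∑sub-cong zero    V       F≗G = cong (_+ 0) (F≗G [] refl)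
∑sub-cong (suc s) []      F≗G = refl
∑sub-cong (suc s) (x ∷ V) {F} {G} F≗G = begin
  ∑sub (suc s) (x ∷ V) F                          ≡⟨ ∑sub-∷ s x V F ⟩
  ∑sub s V (F ∘ (x ∷_)) + ∑sub (suc s) V F        ≡⟨ cong₂ _+_ (∑sub-cong s V λ c eq → F≗G (x ∷ c) (cong suc eq)) (∑sub-cong (suc s) V F≗G) ⟩
  ∑sub s V (G ∘ (x ∷_)) + ∑sub (suc s) V G        ≡⟨ sym (∑sub-∷ s x V G) ⟩
  ∑sub (suc s) (x ∷ V) G                          ∎
  where open ≡-Reasoning

∑sub-map : ∀ s (g : B → A) (V : List B) (F : List A → ℕ) → ∑sub s (map g V) F ≡ ∑sub s V (F ∘ map g)
∑sub-map zero    g V       F = refl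
∑sub-map (suc s) g []      F = refl
∑sub-map (suc s) g (x ∷ V) F = begin
  ∑sub (suc s) (g x ∷ map g V) F                                ≡⟨ ∑sub-∷ s (g x) (map g V) F ⟩
  ∑sub s (map g V) (F ∘ (g x ∷_)) + ∑sub (suc s) (map g V) F    ≡⟨ cong₂ _+_ (∑sub-map s g V _) (∑sub-map (suc s) g V F) ⟩
  ∑sub s V (F ∘ map g ∘ (x ∷_)) + ∑sub (suc s) V (F ∘ map g)    ≡⟨ sym (∑sub-∷ s x V _) ⟩
  ∑sub (suc s) (x ∷ V) (F ∘ map g)                              ∎
  where open ≡-Reasoning

Symmetric : (List A → ℕ) → Set _
Symmetric F = ∀ p x y c → F (p ++ x ∷ y ∷ c) ≡ F (p ++ y ∷ x ∷ c)

-- Double counting of pairs of a subset and one of its elements. Since `subsetsOf` keeps the order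
-- of the list, `F-sym` has to move the picked entry past `y`.
∑pick-∑sub : ∀ s (V : List A) F → Symmetric F →
  ∑pick V (λ x V′ → ∑sub s V′ (F ∘ (x ∷_))) ≡ suc s * ∑sub (suc s) V F
∑pick-∑sub s       []      F F-sym = sym (*-zeroʳ (suc s))
∑pick-∑sub zero    (y ∷ V) F F-sym = begin
  F (y ∷ []) + 0 + ∑pick V (λ x _ → F (x ∷ []) + 0)     ≡⟨ cong (F (y ∷ []) + 0 +_) (∑pick-∑sub zero V F F-sym) ⟩
  F (y ∷ []) + 0 + 1 * ∑sub 1 V F                       ≡⟨ arrange (F (y ∷ []) + 0) (∑sub 1 V F) ⟩
  1 * (F (y ∷ []) + 0 + ∑sub 1 V F)                     ≡⟨ cong (1 *_) (sym (∑sub-∷ 0 y V F)) ⟩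
  1 * ∑sub 1 (y ∷ V) F                                  ∎
  where
  open ≡-Reasoning
  arrange : ∀ a b → a + 1 * b ≡ 1 * (a + b)
  arrange = solve-∀
∑pick-∑sub (suc s) (y ∷ V) F F-sym = begin
  ∑sub (suc s) V F-y + ∑pick V (λ x V′ → ∑sub (suc s) (y ∷ V′) (F ∘ (x ∷_)))
    ≡⟨ cong (∑sub (suc s) V F-y +_) (∑pick-cong V λ x V′ _ → ∑sub-∷ s y V′ (F ∘ (x ∷_))) ⟩
  ∑sub (suc s) V F-y + ∑pick V (λ x V′ → ∑sub s V′ (λ c → F (x ∷ y ∷ c)) + ∑sub (suc s) V′ (F ∘ (x ∷_)))
    ≡⟨ cong (∑sub (suc s) V F-y +_) (∑pick-+ V (λ x V′ → ∑sub s V′ (λ c → F (x ∷ y ∷ c))) _) ⟩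
  ∑sub (suc s) V F-y + (∑pick V (λ x V′ → ∑sub s V′ (λ c → F (x ∷ y ∷ c))) + ∑pick V (λ x V′ → ∑sub (suc s) V′ (F ∘ (x ∷_))))
    ≡⟨ cong (∑sub (suc s) V F-y +_) (cong₂ _+_
         (trans (∑pick-cong V λ x V′ _ → ∑sub-cong s V′ λ c _ → F-sym [] x y c) (∑pick-∑sub s V F-y λ p → F-sym (y ∷ p)))
         (∑pick-∑sub (suc s) V F F-sym)) ⟩
  ∑sub (suc s) V F-y + (suc s * ∑sub (suc s) V F-y + suc (suc s) * ∑sub (suc (suc s)) V F)
    ≡⟨ arrange s (∑sub (suc s) V F-y) (∑sub (suc (suc s)) V F) ⟩
  suc (suc s) * (∑sub (suc s) V F-y + ∑sub (suc (suc s)) V F)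
    ≡⟨ cong (suc (suc s) *_) (sym (∑sub-∷ (suc s) y V F)) ⟩
  suc (suc s) * ∑sub (suc (suc s)) (y ∷ V) F ∎
  where
  open ≡-Reasoning
  F-y = F ∘ (y ∷_)
  arrange : ∀ s a b → a + ((1 + s) * a + (2 + s) * b) ≡ (2 + s) * (a + b)
  arrange = solve-∀

∑inj-∑sub : ∀ s (V : List A) F → Symmetric F → ∑inj s V F ≡ s ! * ∑sub s V F
∑inj-∑sub zero    V F F-sym = trans (sym (+-identityʳ _)) (sym (+-identityʳ _))
∑inj-∑sub (suc s) V F F-sym = begin
  ∑pick V (λ x V′ → ∑inj s V′ (F ∘ (x ∷_)))         ≡⟨ ∑pick-cong V (λ x V′ _ → ∑inj-∑sub s V′ (F ∘ (x ∷_)) λ p → F-sym (x ∷ p)) ⟩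
  ∑pick V (λ x V′ → s ! * ∑sub s V′ (F ∘ (x ∷_)))   ≡⟨ ∑pick-*ˡ (s !) V _ ⟩
  s ! * ∑pick V (λ x V′ → ∑sub s V′ (F ∘ (x ∷_)))   ≡⟨ cong (s ! *_) (∑pick-∑sub s V F F-sym) ⟩
  s ! * (suc s * ∑sub (suc s) V F)                  ≡⟨ arrange (s !) (suc s) _ ⟩
  suc s * s ! * ∑sub (suc s) V F                    ∎
  where
  open ≡-Reasoning
  arrange : ∀ a b c → a * (b * c) ≡ b * a * c
  arrange = solve-∀

𝟙 : Bool → ℕ
𝟙 b = if b then 1 else 0

𝟙≤1 : ∀ b → 𝟙 b ≤ 1
𝟙≤1 false = z≤n
𝟙≤1 true  = ≤-refl

all-++⁻ : (p : A → Bool) (xs : List A) {ys : List A} → all p (xs ++ ys) ≡ true → all p ys ≡ true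
all-++⁻ p []       eq = eq
all-++⁻ p (x ∷ xs) eq with p x
... | true = all-++⁻ p xs eq

all-swap : (p : A → Bool) (xs : List A) (x y : A) (ys : List A) → all p (xs ++ x ∷ y ∷ ys) ≡ all p (xs ++ y ∷ x ∷ ys)
all-swap p []       x y ys with p x | p y
... | false | false = refl
... | false | true  = refl
... | true  | false = refl
... | true  | true  = refl
all-swap p (z ∷ xs) x y ys = cong (p z ∧_) (all-swap p xs x y ys)

∧-trueˡ : ∀ {a b} → a ∧ b ≡ true → a ≡ true
∧-trueˡ {true} eq = refl

∧-trueʳ : ∀ {a b} → a ∧ b ≡ true → b ≡ true
∧-trueʳ {true} eq = eq

module _ (G : Graph) where

  private V = Fin (n G)

  cl : List V → ℕ
  cl c = 𝟙 (isCliqueB G c)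

  -- Repetitions in L count, so a list also encodes a blowup of an induced subgraph.
  hom : ℕ → List V → ℕ
  hom s L = ∑^ s L cl

  𝟙adj : V → V → ℕ
  𝟙adj x y = 𝟙 (adj G x y)

  clique-++⁻ : ∀ p {c} → isCliqueB G (p ++ c) ≡ true → isCliqueB G c ≡ true
  clique-++⁻ []      eq = eq
  clique-++⁻ (x ∷ p) eq = clique-++⁻ p (∧-trueʳ {all (adj G x) (p ++ _)} eq)

  clique-swap : ∀ p x y c → isCliqueB G (p ++ x ∷ y ∷ c) ≡ isCliqueB G (p ++ y ∷ x ∷ c)
  clique-swap []      x y c rewrite Graph.sym G x y
    with adj G y x | all (adj G x) c | all (adj G y) c
  ... | false | _     | _     = refl
  ... | true  | false | false = refl
  ... | true  | false | true  = refl
  ... | true  | true  | false = refl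
  ... | true  | true  | true  = refl
  clique-swap (z ∷ p) x y c = cong₂ _∧_ (all-swap (adj G z) p x y c) (clique-swap p x y c)

  clique-repeat : ∀ p x q c → isCliqueB G (p ++ x ∷ q ++ x ∷ c) ≡ false
  clique-repeat p x q c with isCliqueB G (p ++ x ∷ q ++ x ∷ c) in eq
  ... | false = refl
  ... | true  = contradiction (trans (sym (irrefl G x)) adj-xx) λ ()
    where
    adj-xx : adj G x x ≡ true
    adj-xx = ∧-trueˡ (all-++⁻ (adj G x) q (∧-trueˡ (clique-++⁻ p eq)))

  hom≡∑inj : ∀ s L → hom s L ≡ ∑inj s L cl
  hom≡∑inj s L = ∑^≡∑inj s L cl λ p x q c → cong 𝟙 (clique-repeat p x q c)

  hom≡!*∑sub : ∀ s L → hom s L ≡ s ! * ∑sub s L cl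
  hom≡!*∑sub s L = trans (hom≡∑inj s L) (∑inj-∑sub s L cl λ p x y c → cong 𝟙 (clique-swap p x y c))

  hom-allFin : ∀ s → hom s (allFin (n G)) ≡ s ! * κ s G
  hom-allFin s = hom≡!*∑sub s (allFin (n G))

  hom≤^ : ∀ s L → hom s L ≤ length L ^ s
  hom≤^ s L = ≤-trans (∑^-bound s L λ c _ → 𝟙≤1 _) (≤-reflexive (*-identityʳ _))

  clique-star : ∀ p x q → isCliqueB G (p ++ x ∷ q) ≡ true → product (map (𝟙adj x) (p ++ q)) ≡ 1
  clique-star [] x q eq = star q (∧-trueˡ eq)
    where
    star : ∀ q → all (adj G x) q ≡ true → product (map (𝟙adj x) q) ≡ 1
    star []      eq = refl
    star (y ∷ q) eq with adj G x y
    ... | true = trans (+-identityʳ _) (star q eq)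
  clique-star (z ∷ p) x q eq
    rewrite clique-star p x q (∧-trueʳ {all (adj G z) (p ++ x ∷ q)} eq)
          | Graph.sym G x z
          | ∧-trueˡ {adj G z x} (all-++⁻ (adj G z) p (∧-trueˡ eq)) = refl

module _ {A : Set} {P : Pred A 0ℓ} (P? : Decidable P) where

  in? out? : A → ℕ
  in?  x = if does (P? x) then 1 else 0
  out? x = if does (P? x) then 0 else 1

  ∑-filter : ∀ (V : List A) f → ∑ V (λ x → in? x * f x) ≡ ∑ (filter P? V) f
  ∑-filter []      f = refl
  ∑-filter (x ∷ V) f with does (P? x)
  ... | true  = cong₂ _+_ (+-identityʳ (f x)) (∑-filter V f)
  ... | false = ∑-filter V f

  ∑^-filter : ∀ l (V : List A) F → ∑^ l V (λ c → product (map in? c) * F c) ≡ ∑^ l (filter P? V) F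
  ∑^-filter zero    V F = +-identityʳ (F [])
  ∑^-filter (suc l) V F = begin
    ∑ V (λ x → ∑^ l V (λ c → in? x * product (map in? c) * F (x ∷ c)))
      ≡⟨ ∑-cong V (λ x → trans (∑^-cong l V λ c _ → *-assoc (in? x) (product (map in? c)) (F (x ∷ c)))
                               (∑^-*ˡ (in? x) l V (λ c → product (map in? c) * F (x ∷ c)))) ⟩
    ∑ V (λ x → in? x * ∑^ l V (λ c → product (map in? c) * F (x ∷ c)))
      ≡⟨ ∑-cong V (λ x → cong (in? x *_) (∑^-filter l V (F ∘ (x ∷_)))) ⟩
    ∑ V (λ x → in? x * ∑^ l (filter P? V) (F ∘ (x ∷_)))
      ≡⟨ ∑-filter V _ ⟩
    ∑ (filter P? V) (λ x → ∑^ l (filter P? V) (F ∘ (x ∷_))) ∎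
    where open ≡-Reasoning

  all-or-split : ∀ c → product (map in? c) ≡ 1 ⊎ ∃[ p ] ∃[ x ] ∃[ q ] (c ≡ p ++ x ∷ q × out? x ≡ 1)
  all-or-split []      = inj₁ refl
  all-or-split (x ∷ c) with does (P? x) in eq
  ... | false = inj₂ ([] , x , c , refl , cong (λ b → if b then 0 else 1) eq)
  ... | true with all-or-split c
  ...   | inj₁ all-in                   = inj₁ (trans (+-identityʳ _) all-in)
  ...   | inj₂ (p , y , q , refl , out) = inj₂ (x ∷ p , y , q , refl , out)

≤∑pick : ∀ (p : List A) x q g → g x (p ++ q) ≤ ∑pick (p ++ x ∷ q) g
≤∑pick []      x q g = m≤m+n _ _
≤∑pick (z ∷ p) x q g = ≤-trans (≤∑pick p x q (λ y V′ → g y (z ∷ V′))) (m≤n+m _ _)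

module _ (G : Graph) {P : Pred (Fin (n G)) 0ℓ} (P? : Decidable P) where

  -- A clique that leaves the filtered list has a rejected vertex `x` in one of `suc s` places, and
  -- its other vertices are neighbours of `x`. Forgetting that these are adjacent to one another
  -- lets their sum factor into a power of the degree.
  hom-filter : ∀ s L → hom G (suc s) L ≤
    hom G (suc s) (filter P? L) + suc s * ∑ L (λ x → out? P? x * ∑ L (𝟙adj G x) ^ s)
  hom-filter s L = begin
    ∑^ (suc s) L (cl G)
      ≤⟨ ∑^-mono (suc s) L (λ c _ → pointwise c) ⟩
    ∑^ (suc s) L (λ c → product (map (in? P?) c) * cl G c + ∑pick c g)
      ≡⟨ ∑^-+ (suc s) L (λ c → product (map (in? P?) c) * cl G c) (λ c → ∑pick c g) ⟩
    ∑^ (suc s) L (λ c → product (map (in? P?) c) * cl G c) + ∑^ (suc s) L (λ c → ∑pick c g)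
      ≡⟨ cong₂ _+_ (∑^-filter P? (suc s) L (cl G)) (∑^-∑pick s L g) ⟩
    hom G (suc s) (filter P? L) + suc s * ∑ L (λ x → ∑^ s L (g x))
      ≡⟨ cong (λ z → hom G (suc s) (filter P? L) + suc s * z) (∑-cong L λ x →
           trans (∑^-*ˡ (out? P? x) s L (product ∘ map (𝟙adj G x))) (cong (out? P? x *_) (∑^-product s L (𝟙adj G x)))) ⟩
    hom G (suc s) (filter P? L) + suc s * ∑ L (λ x → out? P? x * ∑ L (𝟙adj G x) ^ s) ∎
    where
    open ≤-Reasoning
    g : Fin (n G) → List (Fin (n G)) → ℕ
    g x c = out? P? x * product (map (𝟙adj G x) c)
    pointwise : ∀ c → cl G c ≤ product (map (in? P?) c) * cl G c + ∑pick c g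
    pointwise c with isCliqueB G c in eq
    ... | false = z≤n
    ... | true with all-or-split P? c
    ...   | inj₁ all-in rewrite all-in = m≤m+n _ _
    ...   | inj₂ (p , x , q , refl , out) = ≤-trans (≤-trans (≤-reflexive (sym g≡1)) (≤∑pick p x q g)) (m≤n+m _ _)
      where
      g≡1 : g x (p ++ q) ≡ 1
      g≡1 rewrite out | clique-star G p x q eq = refl

-- Erdős's theorem on dense l-ary relations

∑inj-*ˡ : ∀ k l (V : List A) F → ∑inj l V (λ c → k * F c) ≡ k * ∑inj l V F
∑inj-*ˡ k zero    V F = refl
∑inj-*ˡ k (suc l) V F = trans (∑pick-cong V λ x V′ _ → ∑inj-*ˡ k l V′ (F ∘ (x ∷_))) (∑pick-*ˡ k V _)

lookup-injective : {xs : List A} → Unique xs → Injective _≡_ _≡_ (lookup xs)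
lookup-injective {xs = x ∷ xs} (x∉ ∷ u) {zero}  {zero}  eq = refl
lookup-injective {xs = x ∷ xs} (x∉ ∷ u) {zero}  {suc j} eq = contradiction eq (All.lookup x∉ (∈-lookup j))
lookup-injective {xs = x ∷ xs} (x∉ ∷ u) {suc i} {zero}  eq = contradiction (sym eq) (All.lookup x∉ (∈-lookup i))
lookup-injective {xs = x ∷ xs} (x∉ ∷ u) {suc i} {suc j} eq = cong suc (lookup-injective u eq)

product≤1 : (f : A → ℕ) → (∀ x → f x ≤ 1) → ∀ xs → product (map f xs) ≤ 1
product≤1 f f≤1 []       = ≤-refl
product≤1 f f≤1 (x ∷ xs) = *-mono-≤ (f≤1 x) (product≤1 f f≤1 xs)

product≡1 : (f : A → ℕ) → ∀ xs → product (map f xs) ≡ 1 → ∀ j → f (lookup xs j) ≡ 1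
product≡1 f (x ∷ xs) eq zero    = m*n≡1⇒m≡1 (f x) _ eq
product≡1 f (x ∷ xs) eq (suc j) = product≡1 f xs (m*n≡1⇒n≡1 (f x) _ eq) j

^-distribʳ-* : ∀ x y k → (x * y) ^ k ≡ x ^ k * y ^ k
^-distribʳ-* x y zero    = refl
^-distribʳ-* x y (suc k) = trans (cong (x * y *_) (^-distribʳ-* x y k)) (arrange x y (x ^ k) (y ^ k))
  where
  arrange : ∀ a b c d → a * b * (c * d) ≡ a * c * (b * d)
  arrange = solve-∀

1≤^ : ∀ {x} k → 1 ≤ x → 1 ≤ x ^ k
1≤^ {x} k 1≤x = subst (_≤ x ^ k) (^-zeroˡ k) (^-monoˡ-≤ k 1≤x)

-- Stands in for the power mean inequality: a value `d` of at most N/(2Θ) is paid for by the first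
-- summand, a larger one by the second.
power-dichotomy : ∀ Θ N d u → 2 * Θ * (N ^ u * d) ≤ N ^ suc u + (2 * Θ) ^ suc u * d ^ suc u
power-dichotomy Θ N d u with ≤-total (2 * Θ * d) N
... | inj₁ 2Θd≤N = begin
  2 * Θ * (N ^ u * d)   ≡⟨ arrange Θ (N ^ u) d ⟩
  2 * Θ * d * N ^ u     ≤⟨ *-monoˡ-≤ (N ^ u) 2Θd≤N ⟩
  N ^ suc u             ≤⟨ m≤m+n _ _ ⟩
  N ^ suc u + (2 * Θ) ^ suc u * d ^ suc u ∎
  where
  open ≤-Reasoning
  arrange : ∀ Θ p d → 2 * Θ * (p * d) ≡ 2 * Θ * d * p
  arrange = solve-∀
... | inj₂ N≤2Θd = begin
  2 * Θ * (N ^ u * d)               ≡⟨ arrange Θ (N ^ u) d ⟩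
  2 * Θ * d * N ^ u                 ≤⟨ *-monoʳ-≤ (2 * Θ * d) (^-monoˡ-≤ u N≤2Θd) ⟩
  (2 * Θ * d) ^ suc u               ≡⟨ ^-distribʳ-* (2 * Θ) d (suc u) ⟩
  (2 * Θ) ^ suc u * d ^ suc u       ≤⟨ m≤n+m _ _ ⟩
  N ^ suc u + (2 * Θ) ^ suc u * d ^ suc u ∎
  where
  open ≤-Reasoning
  arrange : ∀ Θ p d → 2 * Θ * (p * d) ≡ 2 * Θ * d * p
  arrange = solve-∀

-- The induction step of Erdős's argument. The sum of `d c ^ t` over all `c` counts the pairs of a
-- `t`-tuple `τ` and a `c` related to every entry of `τ`; convexity therefore yields a `τ` whose
-- common link is again dense, with arity reduced by one.
module _ (l u Θ : ℕ) (V : List A) (F : List A → ℕ) (F≤1 : ∀ c → F c ≤ 1)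
         (N≥1 : 1 ≤ length V) (N-large : 2 * ((2 * Θ) ^ suc u * (suc u * suc u)) ≤ length V)
         (dense : length V ^ suc l ≤ Θ * ∑^ (suc l) V F) where

  private
    N t W : ℕ
    N = length V
    t = suc u
    W = (2 * Θ) ^ t
    d : List A → ℕ
    d c = ∑ V (λ x → F (x ∷ c))

    link : List A → List A → ℕ
    link τ c = product (map (λ x → F (x ∷ c)) τ)

    codegree : List A → ℕ
    codegree τ = ∑^ l V (link τ)

    ∑d^t : ∑^ l V (λ c → d c ^ t) ≡ ∑^ t V codegree
    ∑d^t = trans (∑^-cong l V λ c _ → sym (∑^-product t V (λ x → F (x ∷ c)))) (∑^-swap l V t V (λ c τ → link τ c))

    codegree≤ : ∀ τ → codegree τ ≤ N ^ l
    codegree≤ τ = ≤-trans (∑^-bound l V λ c _ → product≤1 _ (λ x → F≤1 (x ∷ c)) τ) (≤-reflexive (*-identityʳ _))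

    averaged : N ^ t * N ^ l ≤ W * ∑^ t V codegree
    -- The left side is doubled so that one copy pays for the summand `N ^ t` that `power-dichotomy`
    -- produces for every `c`.
    averaged = +-cancelˡ-≤ (N ^ t * N ^ l) _ _ (begin
      N ^ t * N ^ l + N ^ t * N ^ l
        ≡⟨ arrange N (N ^ u) (N ^ l) ⟩
      2 * N ^ u * (N * N ^ l)
        ≤⟨ *-monoʳ-≤ (2 * N ^ u) dense ⟩
      2 * N ^ u * (Θ * ∑^ (suc l) V F)
        ≡⟨ arrange′ Θ (N ^ u) _ ⟩
      2 * Θ * N ^ u * ∑^ (suc l) V F
        ≡⟨ cong (2 * Θ * N ^ u *_) (∑-∑^-swap V l V (λ x c → F (x ∷ c))) ⟩
      2 * Θ * N ^ u * ∑^ l V d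
        ≡⟨ sym (∑^-*ˡ (2 * Θ * N ^ u) l V d) ⟩
      ∑^ l V (λ c → 2 * Θ * N ^ u * d c)
        ≤⟨ ∑^-mono l V (λ c _ → ≤-trans (≤-reflexive (*-assoc (2 * Θ) (N ^ u) (d c))) (power-dichotomy Θ N (d c) u)) ⟩
      ∑^ l V (λ c → N ^ t + W * d c ^ t)
        ≡⟨ ∑^-+ l V (λ _ → N ^ t) (λ c → W * d c ^ t) ⟩
      ∑^ l V (λ _ → N ^ t) + ∑^ l V (λ c → W * d c ^ t)
        ≡⟨ cong₂ _+_ (trans (∑^-const l V (N ^ t)) (*-comm (N ^ l) _)) (trans (∑^-*ˡ W l V (λ c → d c ^ t)) (cong (W *_) ∑d^t)) ⟩
      N ^ t * N ^ l + W * ∑^ t V codegree ∎)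
      where
      open ≤-Reasoning
      arrange : ∀ n p q → n * p * q + n * p * q ≡ 2 * p * (n * q)
      arrange = solve-∀
      arrange′ : ∀ θ p s → 2 * p * (θ * s) ≡ 2 * θ * p * s
      arrange′ = solve-∀

    averaged-inj : N ^ t * N ^ l ≤ 2 * W * ∑inj t V codegree
    averaged-inj = +-cancelʳ-≤ (N ^ t * N ^ l) _ _ (begin
      N ^ t * N ^ l + N ^ t * N ^ l
        ≤⟨ +-mono-≤ averaged averaged ⟩
      W * S + W * S
        ≡⟨ arrange W S ⟩
      2 * W * S
        ≤⟨ *-monoʳ-≤ (2 * W) (∑^≤∑inj u V codegree≤) ⟩
      2 * W * (∑inj t V codegree + t * t * (N ^ u * N ^ l))
        ≡⟨ arrange′ W (∑inj t V codegree) (t * t) (N ^ u) (N ^ l) ⟩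
      2 * W * ∑inj t V codegree + 2 * (W * (t * t)) * N ^ u * N ^ l
        -- By `N-large`, tuples with a repeated position use up at most half of what `averaged`
        -- provides.
        ≤⟨ +-monoʳ-≤ (2 * W * ∑inj t V codegree) (*-monoˡ-≤ (N ^ l) (*-monoˡ-≤ (N ^ u) N-large)) ⟩
      2 * W * ∑inj t V codegree + N ^ t * N ^ l ∎)
      where
      open ≤-Reasoning
      S = ∑^ t V codegree
      arrange : ∀ w s → w * s + w * s ≡ 2 * w * s
      arrange = solve-∀
      arrange′ : ∀ w s tt p q → 2 * w * (s + tt * (p * q)) ≡ 2 * w * s + 2 * (w * tt) * p * q
      arrange′ = solve-∀

    averaged-strict : N ^ t * N ^ l < ∑inj t V (λ τ → 4 * W * codegree τ)
    -- Doubling once more gives the strict inequality that `∑inj-witness` asks for; this is the 4 in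
    -- `large-link`.
    averaged-strict = begin-strict
      N ^ t * N ^ l                            <⟨ m<m+n (N ^ t * N ^ l) (*-mono-≤ (1≤^ t N≥1) (1≤^ l N≥1)) ⟩
      N ^ t * N ^ l + N ^ t * N ^ l            ≤⟨ +-mono-≤ averaged-inj averaged-inj ⟩
      2 * W * S + 2 * W * S                    ≡⟨ arrange W S ⟩
      4 * W * S                                ≡⟨ sym (∑inj-*ˡ (4 * W) t V codegree) ⟩
      ∑inj t V (λ τ → 4 * W * codegree τ)      ∎
      where
      open ≤-Reasoning
      S = ∑inj t V codegree
      arrange : ∀ w s → 2 * w * s + 2 * w * s ≡ 4 * w * s
      arrange = solve-∀

  large-link : ∃[ τ ] (length τ ≡ suc u × (Unique V → Unique τ) × length V ^ l ≤ 4 * (2 * Θ) ^ suc u * ∑^ l V (link τ))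
  large-link = let τ , len , _ , uniq , lt = ∑inj-witness t V (λ τ → 4 * W * codegree τ) (N ^ l) averaged-strict
               in τ , len , uniq , <⇒≤ lt

-- A complete `l`-partite configuration with classes of size `t`. Different classes may overlap
-- here; for cliques, irreflexivity separates them later.
BoxIn : ∀ {A : Set} → ℕ → ℕ → (List A → ℕ) → Set
BoxIn {A} l t F = Σ (Fin l → Fin t → A) λ τ →
  (∀ i → Injective _≡_ _≡_ (τ i)) × (∀ (p : Fin l → Fin t) → F (tabulate (λ i → τ i (p i))) ≡ 1)

box-∷ : ∀ {l} (F : List A → ℕ) τ₀ {t} → length τ₀ ≡ t → Unique τ₀ →
  BoxIn l t (λ c → product (map (λ x → F (x ∷ c)) τ₀)) → BoxIn (suc l) t F
box-∷ F τ₀ refl uniq (τ , inj , τ-F) =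
    (λ { zero → lookup τ₀ ; (suc i) → τ i })
  , (λ { zero → lookup-injective uniq ; (suc i) → inj i })
  , λ p → product≡1 (λ x → F (x ∷ _)) τ₀ (τ-F (p ∘ suc)) (p zero)

-- Induction on the arity. The reciprocal density of the link depends on `Θ` and `u` alone, so `N₀`
-- can be fixed before `V` and `F`.
kst : ∀ l u Θ → ∃[ N₀ ] (∀ {A : Set} (V : List A) → Unique V → N₀ ≤ length V →
  ∀ F → (∀ c → F c ≤ 1) → length V ^ l ≤ Θ * ∑^ l V F → BoxIn l (suc u) F)
kst zero    u Θ = 0 , λ V _ _ F F≤1 dense → (λ ()) , (λ ()) , λ p → ≤-antisym (F≤1 []) (positive (F []) dense)
  where
  positive : ∀ x → 1 ≤ Θ * x → 1 ≤ x
  positive zero    h = contradiction (subst (1 ≤_) (*-zeroʳ Θ) h) λ ()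
  positive (suc x) h = s≤s z≤n
kst (suc l) u Θ = 1 + (N₁ + N₂) , λ V uniq N≥ F F≤1 dense →
  let N₁+N₂≤N = m+n≤o⇒n≤o 1 N≥
      τ₀ , len , uniq₀ , dense₀ = large-link l u Θ V F F≤1 (m+n≤o⇒m≤o 1 N≥) (m+n≤o⇒m≤o N₁ N₁+N₂≤N) dense
  in box-∷ F τ₀ len (uniq₀ uniq)
       (proj₂ IH V uniq (m+n≤o⇒n≤o N₁ N₁+N₂≤N) (λ c → product (map (λ x → F (x ∷ c)) τ₀))
         (λ c → product≤1 _ (λ x → F≤1 (x ∷ c)) τ₀) dense₀)
  where
  IH = kst l u (4 * (2 * Θ) ^ suc u)
  N₁ = 2 * ((2 * Θ) ^ suc u * (suc u * suc u))
  N₂ = proj₁ IH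

complete-adj⁻ : ∀ {k} i j → adj (complete k) i j ≡ true → i ≢ j
complete-adj⁻ {k} i .i eq refl = contradiction (trans (sym eq) (irrefl (complete k) i)) λ ()

complete-adj⁺ : ∀ {k} i j → i ≢ j → adj (complete k) i j ≡ true
complete-adj⁺ i j i≢j with i Fin.≟ j
... | yes i≡j = contradiction i≡j i≢j
... | no  _   = refl

module _ (G : Graph) where

  all-tabulate⁻ : ∀ {k} (p : Fin (n G) → Bool) (f : Fin k → Fin (n G)) → all p (tabulate f) ≡ true → ∀ j → p (f j) ≡ true
  all-tabulate⁻ p f eq zero    = ∧-trueˡ eq
  all-tabulate⁻ p f eq (suc j) = all-tabulate⁻ p (f ∘ suc) (∧-trueʳ {p (f zero)} eq) j

  all-tabulate⁺ : ∀ {k} (p : Fin (n G) → Bool) (f : Fin k → Fin (n G)) → (∀ j → p (f j) ≡ true) → all p (tabulate f) ≡ true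
  all-tabulate⁺ {zero}  p f eq = refl
  all-tabulate⁺ {suc k} p f eq = cong₂ _∧_ (eq zero) (all-tabulate⁺ p (f ∘ suc) (eq ∘ suc))

  clique-tabulate⁻ : ∀ {k} (f : Fin k → Fin (n G)) → isCliqueB G (tabulate f) ≡ true → ∀ i j → i ≢ j → adj G (f i) (f j) ≡ true
  clique-tabulate⁻ f eq zero    zero    i≢j = contradiction refl i≢j
  clique-tabulate⁻ f eq zero    (suc j) i≢j = all-tabulate⁻ (adj G (f zero)) (f ∘ suc) (∧-trueˡ eq) j
  clique-tabulate⁻ f eq (suc i) zero    i≢j =
    trans (Graph.sym G _ _) (all-tabulate⁻ (adj G (f zero)) (f ∘ suc) (∧-trueˡ eq) i)
  clique-tabulate⁻ f eq (suc i) (suc j) i≢j =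
    clique-tabulate⁻ (f ∘ suc) (∧-trueʳ {all (adj G (f zero)) (tabulate (f ∘ suc))} eq) i j (i≢j ∘ cong suc)

  clique-tabulate⁺ : ∀ {k} (f : Fin k → Fin (n G)) → (∀ i j → i ≢ j → adj G (f i) (f j) ≡ true) → isCliqueB G (tabulate f) ≡ true
  clique-tabulate⁺ {zero}  f adj-f = refl
  clique-tabulate⁺ {suc k} f adj-f = cong₂ _∧_
    (all-tabulate⁺ (adj G (f zero)) (f ∘ suc) (λ j → adj-f zero (suc j) λ ()))
    (clique-tabulate⁺ (f ∘ suc) (λ i j i≢j → adj-f (suc i) (suc j) λ { refl → i≢j refl }))

𝟙≡1 : ∀ {b} → 𝟙 b ≡ 1 → b ≡ true
𝟙≡1 {true} eq = refl

supersaturation : ∀ k u Θ → ∃[ N₀ ] (∀ (G : Graph) V → Unique V → N₀ ≤ length V →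
  length V ^ k ≤ Θ * hom G k V → Contains G (blowup (complete k) (suc u)))
supersaturation k u Θ = proj₁ (kst k u Θ) , λ G V uniq N≥ dense →
  contains G (proj₂ (kst k u Θ) V uniq N≥ (cl G) (λ c → 𝟙≤1 (isCliqueB G c)) dense)
  where
  t = suc u
  contains : ∀ G → BoxIn k t (cl G) →
    Contains G (blowup (complete k) t)
  contains G (τ , inj , τ-clique) = f , f-inj , λ x y eq → adjacent (complete-adj⁻ _ _ eq) _ _
    where
    f : Fin (k * t) → Fin (n G)
    f x = τ (quotient {k} t x) (remainder {k} t x)

    adjacent : ∀ {i j} → i ≢ j → ∀ x y → adj G (τ i x) (τ j y) ≡ true
    adjacent {i} {j} i≢j x y =
      trans (cong₂ (λ x y → adj G (τ i x) (τ j y)) (sym p-i) (sym p-j))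
        (clique-tabulate⁻ G (λ m → τ m (p m)) (𝟙≡1 (τ-clique p)) i j i≢j)
      where
      -- A transversal through `x` in class `i` and `y` in all other classes; it spans a clique.
      p : Fin k → Fin t
      p m with m Fin.≟ i
      ... | yes _ = x
      ... | no  _ = y
      p-i : p i ≡ x
      p-i with i Fin.≟ i
      ... | yes _   = refl
      ... | no  i≢i = contradiction refl i≢i
      p-j : p j ≡ y
      p-j with j Fin.≟ i
      ... | yes j≡i = contradiction (sym j≡i) i≢j
      ... | no  _   = refl

    f-inj : Injective _≡_ _≡_ f
    f-inj {x} {y} eq with quotient {k} t x Fin.≟ quotient {k} t y
    -- Vertices of different classes have adjacent images, so equal images would form a loop.
    ... | no  q≢ = contradiction
            (trans (sym (adjacent q≢ (remainder {k} t x) (remainder {k} t y))) (trans (cong (adj G (f x)) (sym eq)) (irrefl G (f x)))) λ ()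
    ... | yes q≡ = begin
      x                                            ≡⟨ sym (combine-remQuot {k} t x) ⟩
      combine {k} {t} (quotient {k} t x) (remainder {k} t x)       ≡⟨ cong₂ (combine {k} {t}) q≡ (inj (quotient {k} t y) (trans (cong (λ i → τ i (remainder {k} t x)) (sym q≡)) eq)) ⟩
      combine {k} {t} (quotient {k} t y) (remainder {k} t y)       ≡⟨ combine-remQuot {k} t y ⟩
      y                                            ∎
      where open ≡-Reasoning

-- Concentration of the edge count of a random sample

cancel-≤ : ∀ {o x y} → 1 ≤ o → o * x ≤ o * y → x ≤ y
cancel-≤ {o} 1≤o = *-cancelˡ-≤ o {{>-nonZero 1≤o}}

𝟙? : {P : Set} → Dec P → ℕ
𝟙? (yes _) = 1
𝟙? (no  _) = 0

𝟙?-cases : {P : Set} (d : Dec P) → (𝟙? d ≡ 1 × P) ⊎ (𝟙? d ≡ 0 × ¬ P)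
𝟙?-cases (yes p) = inj₁ (refl , p)
𝟙?-cases (no ¬p) = inj₂ (refl , ¬p)

-- Chebyshev before averaging: δ² b ≤ (y - ν)², where `b` marks a deviation, with the mixed term
-- moved to the left to avoid subtraction.
square-gap : ∀ y ν δ b → (b ≡ 0 ⊎ b ≡ 1 × ν + δ ≤ y) → δ * δ * b + 2 * ν * y ≤ y * y + ν * ν
square-gap y ν δ b (inj₁ refl) = begin
  δ * δ * 0 + 2 * ν * y   ≡⟨ cong (_+ 2 * ν * y) (*-zeroʳ (δ * δ)) ⟩
  2 * ν * y               ≤⟨ gap (≤-total ν y) ⟩
  y * y + ν * ν           ∎
  where
  open ≤-Reasoning
  expand : ∀ p z → (p + z) * (p + z) + p * p ≡ 2 * p * (p + z) + z * z
  expand = solve-∀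
  expand′ : ∀ p z → p * p + (p + z) * (p + z) ≡ 2 * (p + z) * p + z * z
  expand′ = solve-∀
  gap : ν ≤ y ⊎ y ≤ ν → 2 * ν * y ≤ y * y + ν * ν
  gap (inj₁ ν≤y) with z , refl ← m≤n⇒∃[o]m+o≡n ν≤y = ≤-trans (m≤m+n _ (z * z)) (≤-reflexive (sym (expand ν z)))
  gap (inj₂ y≤ν) with z , refl ← m≤n⇒∃[o]m+o≡n y≤ν = ≤-trans (m≤m+n _ (z * z)) (≤-reflexive (sym (expand′ y z)))
square-gap y ν δ b (inj₂ (refl , far)) with z , refl ← m≤n⇒∃[o]m+o≡n far = ≤-trans (m≤m+n _ _) (≤-reflexive (expand ν δ z))
  where
  expand : ∀ ν δ z → δ * δ * 1 + 2 * ν * (ν + δ + z) + (2 * δ * z + z * z) ≡ (ν + δ + z) * (ν + δ + z) + ν * ν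
  expand = solve-∀

k²≤falling+k : ∀ k → k * k ≤ falling k 2 + k
k²≤falling+k zero          = z≤n
k²≤falling+k (suc zero)    = ≤-refl
k²≤falling+k (suc (suc k)) = ≤-reflexive (arrange k)
  where
  arrange : ∀ k → (2 + k) * (2 + k) ≡ (2 + k) * ((1 + k) * 1) + (2 + k)
  arrange = solve-∀

module _ (G : Graph) where

  -- Two edges written as one quadruple. This turns the square of the edge count into a sum over
  -- 4-tuples, to which `∑^-∑inj` applies.
  pairs : List (Fin (n G)) → ℕ
  pairs c = cl G (take 2 c) * cl G (drop 2 c)

  pairs≤1 : ∀ c → pairs c ≤ 1
  pairs≤1 c = *-mono-≤ (𝟙≤1 (isCliqueB G (take 2 c))) (𝟙≤1 (isCliqueB G (drop 2 c)))

  ∑^-pairs : ∀ V → ∑^ 4 V pairs ≡ hom G 2 V * hom G 2 V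
  ∑^-pairs V = begin
    ∑^ 2 V (λ c → ∑^ 2 V (λ d → cl G c * cl G d))  ≡⟨ ∑^-cong 2 V {G = λ c → cl G c * hom G 2 V} (λ c _ → ∑^-*ˡ (cl G c) 2 V (cl G)) ⟩
    ∑^ 2 V (λ c → cl G c * hom G 2 V)              ≡⟨ ∑^-*ʳ (hom G 2 V) 2 V (cl G) ⟩
    hom G 2 V * hom G 2 V                          ∎
    where open ≡-Reasoning

  module _ (V : List (Fin (n G))) (k b : ℕ) where

    private
      N E : ℕ
      N = length V
      E = hom G 2 V

    -- e(φ) exceeds its approximate mean k²E/N² by more than k²/b.
    Dense : List (Fin (n G)) → Set
    Dense φ = b * (k * k * E) + N * N * (k * k) < b * (N * N * hom G 2 φ)

    dense? : ∀ φ → Dec (Dense φ)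
    dense? φ = b * (k * k * E) + N * N * (k * k) <? b * (N * N * hom G 2 φ)

    𝟙dense : List (Fin (n G)) → ℕ
    𝟙dense φ = 𝟙? (dense? φ)

    private
      first-moment : N * N * ∑^ k V (hom G 2) ≡ falling k 2 * (N ^ k * E)
      first-moment = trans (cong₂ _*_ (sym (cong (N *_) (*-identityʳ N))) (∑^-cong k V λ φ _ → hom≡∑inj G 2 φ))
                           (∑^-∑inj k 2 V (cl G))

      -- Pairs of edges on four distinct positions are independent and give the main term;
      -- `16 * k ^ 3` is the error of `∑^≤∑inj` for quadruples with a repeated position.
      second-moment : N ^ 4 * ∑^ k V (λ φ → hom G 2 φ * hom G 2 φ) ≤ k ^ 4 * (N ^ k * (E * E)) + N ^ 4 * (N ^ k * (16 * k ^ 3))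
      second-moment = begin
        N ^ 4 * ∑^ k V (λ φ → hom G 2 φ * hom G 2 φ)
          ≤⟨ *-monoʳ-≤ (N ^ 4) (∑^-mono k V λ φ len → ≤-trans (≤-reflexive (sym (∑^-pairs φ)))
               (≤-trans (∑^≤∑inj 3 φ pairs≤1) (+-monoʳ-≤ (∑inj 4 φ pairs) (≤-reflexive (cong (16 *_) (trans (*-identityʳ _) (cong (_^ 3) len))))))) ⟩
        N ^ 4 * ∑^ k V (λ φ → ∑inj 4 φ pairs + 16 * k ^ 3)
          ≡⟨ cong (N ^ 4 *_) (trans (∑^-+ k V _ _) (cong (∑^ k V (λ φ → ∑inj 4 φ pairs) +_) (∑^-const k V _))) ⟩
        N ^ 4 * (∑^ k V (λ φ → ∑inj 4 φ pairs) + N ^ k * (16 * k ^ 3))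
          ≡⟨ *-distribˡ-+ (N ^ 4) _ _ ⟩
        N ^ 4 * ∑^ k V (λ φ → ∑inj 4 φ pairs) + N ^ 4 * (N ^ k * (16 * k ^ 3))
          ≡⟨ cong (_+ N ^ 4 * (N ^ k * (16 * k ^ 3))) (trans (∑^-∑inj k 4 V pairs) (cong (λ z → falling k 4 * (N ^ k * z)) (∑^-pairs V))) ⟩
        falling k 4 * (N ^ k * (E * E)) + N ^ 4 * (N ^ k * (16 * k ^ 3))
          ≤⟨ +-monoˡ-≤ _ (*-monoˡ-≤ _ (falling≤^ k 4)) ⟩
        k ^ 4 * (N ^ k * (E * E)) + N ^ 4 * (N ^ k * (16 * k ^ 3)) ∎
        where open ≤-Reasoning

      pointwise : ∀ φ → N * N * (k * k) * (N * N * (k * k)) * 𝟙dense φ + 2 * (b * (k * k * E)) * (b * (N * N)) * hom G 2 φ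
                      ≤ b * b * N ^ 4 * (hom G 2 φ * hom G 2 φ) + b * (k * k * E) * (b * (k * k * E))
      pointwise φ = begin
        δ * δ * 𝟙dense φ + 2 * ν * (b * (N * N)) * e     ≡⟨ cong (δ * δ * 𝟙dense φ +_) (arrange₁ ν b N e) ⟩
        δ * δ * 𝟙dense φ + 2 * ν * (b * (N * N * e))     ≤⟨ square-gap (b * (N * N * e)) ν δ (𝟙dense φ) far ⟩
        b * (N * N * e) * (b * (N * N * e)) + ν * ν      ≡⟨ cong (_+ ν * ν) (arrange₂ b N e) ⟩
        b * b * N ^ 4 * (e * e) + ν * ν                  ∎
        where
        open ≤-Reasoning
        e = hom G 2 φ
        δ = N * N * (k * k)
        ν = b * (k * k * E)
        far : 𝟙dense φ ≡ 0 ⊎ 𝟙dense φ ≡ 1 × ν + δ ≤ b * (N * N * e)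
        far with 𝟙?-cases (dense? φ)
        ... | inj₁ (eq , lt) = inj₂ (eq , <⇒≤ lt)
        ... | inj₂ (eq , _)  = inj₁ eq
        arrange₁ : ∀ ν b N e → 2 * ν * (b * (N * N)) * e ≡ 2 * ν * (b * (N * N * e))
        arrange₁ = solve-∀
        arrange₂ : ∀ b N e → b * (N * N * e) * (b * (N * N * e)) ≡ b * b * (N * (N * (N * (N * 1)))) * (e * e)
        arrange₂ = solve-∀

      summed : N * N * (k * k) * (N * N * (k * k)) * ∑^ k V 𝟙dense + 2 * (b * (k * k * E)) * b * (falling k 2 * (N ^ k * E))
             ≤ b * b * (k ^ 4 * (N ^ k * (E * E)) + N ^ 4 * (N ^ k * (16 * k ^ 3))) + N ^ k * (b * (k * k * E) * (b * (k * k * E)))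
      summed = begin
        δ * δ * ∑^ k V 𝟙dense + 2 * ν * b * (falling k 2 * (N ^ k * E))
          ≡⟨ cong (λ z → δ * δ * ∑^ k V 𝟙dense + 2 * ν * b * z) (sym first-moment) ⟩
        δ * δ * ∑^ k V 𝟙dense + 2 * ν * b * (N * N * S)
          ≡⟨ cong (δ * δ * ∑^ k V 𝟙dense +_) (arrange ν b (N * N) S) ⟩
        δ * δ * ∑^ k V 𝟙dense + 2 * ν * (b * (N * N)) * S
          ≡⟨ cong₂ _+_ (sym (∑^-*ˡ (δ * δ) k V 𝟙dense)) (sym (∑^-*ˡ (2 * ν * (b * (N * N))) k V (hom G 2))) ⟩
        ∑^ k V (λ φ → δ * δ * 𝟙dense φ) + ∑^ k V (λ φ → 2 * ν * (b * (N * N)) * hom G 2 φ)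
          ≡⟨ sym (∑^-+ k V (λ φ → δ * δ * 𝟙dense φ) (λ φ → 2 * ν * (b * (N * N)) * hom G 2 φ)) ⟩
        ∑^ k V (λ φ → δ * δ * 𝟙dense φ + 2 * ν * (b * (N * N)) * hom G 2 φ)
          ≤⟨ ∑^-mono k V (λ φ _ → pointwise φ) ⟩
        ∑^ k V (λ φ → b * b * N ^ 4 * (hom G 2 φ * hom G 2 φ) + ν * ν)
          ≡⟨ trans (∑^-+ k V (λ φ → b * b * N ^ 4 * (hom G 2 φ * hom G 2 φ)) (λ _ → ν * ν))
               (cong₂ _+_ (trans (∑^-*ˡ (b * b * N ^ 4) k V (λ φ → hom G 2 φ * hom G 2 φ)) (*-assoc (b * b) (N ^ 4) _)) (∑^-const k V _)) ⟩
        b * b * (N ^ 4 * ∑^ k V (λ φ → hom G 2 φ * hom G 2 φ)) + N ^ k * (ν * ν)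
          ≤⟨ +-monoˡ-≤ (N ^ k * (ν * ν)) (*-monoʳ-≤ (b * b) second-moment) ⟩
        b * b * (k ^ 4 * (N ^ k * (E * E)) + N ^ 4 * (N ^ k * (16 * k ^ 3))) + N ^ k * (ν * ν) ∎
        where
        open ≤-Reasoning
        δ = N * N * (k * k)
        ν = b * (k * k * E)
        S = ∑^ k V (hom G 2)
        arrange : ∀ ν b M S → 2 * ν * b * (M * S) ≡ 2 * ν * (b * M) * S
        arrange = solve-∀

    -- Of the constant 18, 16 comes from `second-moment` and 2 from replacing `falling k 2` by k² in
    -- the mean, where E ≤ N². The terms in k⁴E² cancel, so the variance has only order k³.
    chebyshev : 1 ≤ N → 1 ≤ k → k * ∑^ k V 𝟙dense ≤ 18 * (b * b) * N ^ k
    chebyshev 1≤N 1≤k = cancel-≤ {N ^ 4 * k ^ 3} (*-mono-≤ (1≤^ 4 1≤N) (1≤^ 3 1≤k)) (+-cancelʳ-≤ (2 * (b * b) * k ^ 4 * (E * E) * P) _ _ (begin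
      N ^ 4 * k ^ 3 * (k * S) + 2 * (b * b) * k ^ 4 * (E * E) * P
        ≡⟨ arrange₁ N k b E P S ⟩
      δ * δ * S + 2 * (b * (k * k * E)) * b * (k * k * (P * E))
        ≤⟨ +-monoʳ-≤ (δ * δ * S) (*-monoʳ-≤ (2 * (b * (k * k * E)) * b) (*-monoˡ-≤ (P * E) (k²≤falling+k k))) ⟩
      δ * δ * S + 2 * (b * (k * k * E)) * b * ((f + k) * (P * E))
        ≡⟨ arrange₂ (δ * δ * S) b k E P f ⟩
      δ * δ * S + 2 * (b * (k * k * E)) * b * (f * (P * E)) + 2 * (b * b) * k ^ 3 * P * (E * E)
        ≤⟨ +-mono-≤ summed (*-monoʳ-≤ (2 * (b * b) * k ^ 3 * P) (*-mono-≤ (hom≤^ G 2 V) (hom≤^ G 2 V))) ⟩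
      b * b * (k ^ 4 * (P * (E * E)) + N ^ 4 * (P * (16 * k ^ 3))) + P * (b * (k * k * E) * (b * (k * k * E)))
        + 2 * (b * b) * k ^ 3 * P * (N ^ 2 * N ^ 2)
        ≡⟨ arrange₃ N k b E P ⟩
      N ^ 4 * k ^ 3 * (18 * (b * b) * P) + 2 * (b * b) * k ^ 4 * (E * E) * P ∎))
      where
      open ≤-Reasoning
      S = ∑^ k V 𝟙dense
      P = N ^ k
      f = falling k 2
      δ = N * N * (k * k)
      arrange₁ : ∀ N k b E P S →
        N * (N * (N * (N * 1))) * (k * (k * (k * 1))) * (k * S) + 2 * (b * b) * (k * (k * (k * (k * 1)))) * (E * E) * P
        ≡ N * N * (k * k) * (N * N * (k * k)) * S + 2 * (b * (k * k * E)) * b * (k * k * (P * E))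
      arrange₁ = solve-∀
      arrange₂ : ∀ x b k E P f → x + 2 * (b * (k * k * E)) * b * ((f + k) * (P * E))
        ≡ x + 2 * (b * (k * k * E)) * b * (f * (P * E)) + 2 * (b * b) * (k * (k * (k * 1))) * P * (E * E)
      arrange₂ = solve-∀
      arrange₃ : ∀ N k b E P →
        b * b * (k * (k * (k * (k * 1))) * (P * (E * E)) + N * (N * (N * (N * 1))) * (P * (16 * (k * (k * (k * 1))))))
          + P * (b * (k * k * E) * (b * (k * k * E))) + 2 * (b * b) * (k * (k * (k * 1))) * P * (N * (N * 1) * (N * (N * 1)))
        ≡ N * (N * (N * (N * 1))) * (k * (k * (k * 1))) * (18 * (b * b) * P) + 2 * (b * b) * (k * (k * (k * (k * 1)))) * (E * E) * P
      arrange₃ = solve-∀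

-- Comparing a list with few cliques to its samples

divide : ∀ x d → 1 ≤ d → ∃[ q ] (d * q ≤ x × x ≤ d * suc q)
divide zero    d 1≤d = 0 , ≤-reflexive (*-zeroʳ d) , z≤n
divide (suc x) d 1≤d with divide x d 1≤d
... | q , lo , hi with d * suc q ≤? suc x
...   | yes lo′ = suc q , lo′ , ≤-trans (s≤s hi) (≤-trans (≤-reflexive (+-comm 1 (d * suc q)))
                    (≤-trans (+-monoʳ-≤ (d * suc q) 1≤d) (≤-reflexive (trans (+-comm _ d) (sym (*-suc d (suc q)))))))
...   | no  hi′ = q , m≤n⇒m≤1+n lo , <⇒≤ (≰⇒> hi′)

scaled-falling≤ : ∀ q k l N → q * k ≤ N → q ^ l * falling k l ≤ N ^ l
scaled-falling≤ q k l N qk≤N = begin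
  q ^ l * falling k l   ≤⟨ *-monoʳ-≤ (q ^ l) (falling≤^ k l) ⟩
  q ^ l * k ^ l         ≡⟨ sym (^-distribʳ-* q k l) ⟩
  (q * k) ^ l           ≤⟨ ^-monoˡ-≤ l qk≤N ⟩
  N ^ l                 ∎
  where open ≤-Reasoning

-- Each of the `l` factors q(k - i) of `q ^ l * falling k l` is at least (1 - 1/C)N, and (1 - 1/C)^l
-- ≥ 1 - l/C. The variable `k′` covers the values k - i without subtraction.
bernoulli : ∀ C q N k l → q * k ≤ N → (∀ k′ → k ≤ k′ + l → C * N ≤ C * (q * k′) + N) →
  C * N ^ l ≤ C * (q ^ l * falling k l) + l * N ^ l
bernoulli C q N k       zero    _    _    = ≤-reflexive (arrange C)
  where
  arrange : ∀ C → C * 1 ≡ C * (1 * 1) + 0 * 1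
  arrange = solve-∀
bernoulli C q N zero    (suc l) _    near = begin
  C * (N * N ^ l)                                 ≡⟨ sym (*-assoc C N _) ⟩
  C * N * N ^ l                                   ≤⟨ *-monoˡ-≤ (N ^ l) (near 0 z≤n) ⟩
  (C * (q * 0) + N) * N ^ l                       ≡⟨ arrange C q N (N ^ l) ⟩
  N ^ suc l                                       ≤⟨ m≤m+n _ _ ⟩
  suc l * N ^ suc l                               ≤⟨ m≤n+m _ (C * (q ^ suc l * 0)) ⟩
  C * (q ^ suc l * 0) + suc l * N ^ suc l         ∎
  where
  open ≤-Reasoning
  arrange : ∀ C q N p → (C * (q * 0) + N) * p ≡ N * p
  arrange = solve-∀
bernoulli C q N (suc k) (suc l) qk≤N near = begin
  C * (N * N ^ l)
    ≡⟨ arrange₁ C N (N ^ l) ⟩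
  N * (C * N ^ l)
    ≤⟨ *-monoʳ-≤ N (bernoulli C q N k l qk′≤N λ k′ le → near k′ (≤-trans (s≤s le) (≤-reflexive (sym (+-suc k′ l))))) ⟩
  N * (C * R + l * N ^ l)
    ≡⟨ arrange₂ C N R l (N ^ l) ⟩
  C * N * R + l * (N * N ^ l)
    ≤⟨ +-monoˡ-≤ _ (*-monoˡ-≤ R (near (suc k) (m≤m+n (suc k) (suc l)))) ⟩
  (C * (q * suc k) + N) * R + l * (N * N ^ l)
    ≡⟨ arrange₃ C q (suc k) N (q ^ l) (falling k l) (l * (N * N ^ l)) ⟩
  C * (q * q ^ l * (suc k * falling k l)) + (N * R + l * (N * N ^ l))
    ≤⟨ +-monoʳ-≤ (C * (q * q ^ l * (suc k * falling k l))) (+-monoˡ-≤ (l * (N * N ^ l)) (*-monoʳ-≤ N (scaled-falling≤ q k l N qk′≤N))) ⟩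
  C * (q ^ suc l * falling (suc k) (suc l)) + suc l * N ^ suc l ∎
  where
  open ≤-Reasoning
  R = q ^ l * falling k l
  qk′≤N : q * k ≤ N
  qk′≤N = ≤-trans (*-monoʳ-≤ q (n≤1+n k)) qk≤N
  arrange₁ : ∀ C N p → C * (N * p) ≡ N * (C * p)
  arrange₁ = solve-∀
  arrange₂ : ∀ C N R l p → N * (C * R + l * p) ≡ C * N * R + l * (N * p)
  arrange₂ = solve-∀
  arrange₃ : ∀ C q k N p f e → (C * (q * k) + N) * (p * f) + e ≡ C * (q * p * (k * f)) + (N * (p * f) + e)
  arrange₃ = solve-∀

module _ (G : Graph) (V : List (Fin (n G))) (ρ s C A m Q k q : ℕ) where

  private
    N E g b : ℕ
    N = length V
    E = hom G 2 V
    g = 3 * C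
    b = A * A * g

  module _
    (1≤A : 1 ≤ A) (1≤C : 1 ≤ C) (1≤k : 1 ≤ k) (1≤N : 1 ≤ N)
    (E≤2m : E ≤ 2 * m) (N²≤A²m : N * N ≤ A * A * m)
    -- So `q` is N/k, shrunk by the factor g/(1 + g) and rounded.
    (q-lo : (1 + g) * k * q ≤ g * N) (q-hi : g * N ≤ (1 + g) * k * suc q)
    (few-dense : C * ∑^ k V (𝟙dense G V k b) ≤ N ^ k)
    (few-cliques : C * k ^ ρ * hom G ρ V ≤ N ^ ρ)
    (extremal : ∀ L → hom G ρ L ≡ 0 → hom G 2 L ≤ 2 * m → hom G s L ≤ Q)
    where

    private
      1≤g : 1 ≤ g
      1≤g = ≤-trans 1≤C (m≤n*m C 3)

      1≤b : 1 ≤ b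
      1≤b = *-mono-≤ (*-mono-≤ 1≤A 1≤A) 1≤g

    qk≤N : q * k ≤ N
    qk≤N = cancel-≤ {1 + g} (s≤s z≤n) (begin
      (1 + g) * (q * k)    ≡⟨ trans (cong ((1 + g) *_) (*-comm q k)) (sym (*-assoc (1 + g) k q)) ⟩
      (1 + g) * k * q      ≤⟨ q-lo ⟩
      g * N                ≤⟨ *-monoˡ-≤ N (n≤1+n g) ⟩
      (1 + g) * N          ∎)
      where open ≤-Reasoning

    -- The admissible deviation k²/b becomes at most N²/b ≤ m/g after the blowup, by the choice b =
    -- A²g. Shrinking `q` compensates for it, since (1 + 1/g)² ≥ 1 + 1/(2g).
    few-edges : ∀ φ → ¬ Dense G V k b φ → q ^ 2 * hom G 2 φ ≤ 2 * m
    few-edges φ ¬dense = cancel-≤ {b * ((1 + g) * (1 + g)) * (N * N)}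
      (*-mono-≤ (*-mono-≤ 1≤b (s≤s z≤n)) (*-mono-≤ 1≤N 1≤N)) (begin
      b * ((1 + g) * (1 + g)) * (N * N) * (q ^ 2 * e)
        ≡⟨ arrange₁ b g N q e ⟩
      (1 + g) * (1 + g) * (q * q) * (b * (N * N * e))
        ≤⟨ *-monoʳ-≤ ((1 + g) * (1 + g) * (q * q)) (≮⇒≥ ¬dense) ⟩
      (1 + g) * (1 + g) * (q * q) * (b * (k * k * E) + N * N * (k * k))
        ≡⟨ arrange₂ g q b k E (N * N) ⟩
      ((1 + g) * k * q) * ((1 + g) * k * q) * (b * E + N * N)
        ≤⟨ *-mono-≤ (*-mono-≤ q-lo q-lo) (+-mono-≤ (*-monoʳ-≤ b E≤2m) N²≤A²m) ⟩
      (g * N) * (g * N) * (b * (2 * m) + A * A * m)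
        ≤⟨ m≤m+n _ (m * (A * A) * (N * N) * g * (3 * g + 2)) ⟩
      (g * N) * (g * N) * (A * A * g * (2 * m) + A * A * m) + m * (A * A) * (N * N) * g * (3 * g + 2)
        ≡⟨ arrange₃ g N A m ⟩
      b * ((1 + g) * (1 + g)) * (N * N) * (2 * m) ∎)
      where
      open ≤-Reasoning
      e = hom G 2 φ
      arrange₁ : ∀ b g N q e → b * ((1 + g) * (1 + g)) * (N * N) * (q * (q * 1) * e) ≡ (1 + g) * (1 + g) * (q * q) * (b * (N * N * e))
      arrange₁ = solve-∀
      arrange₂ : ∀ g q b k E M → (1 + g) * (1 + g) * (q * q) * (b * (k * k * E) + M * (k * k)) ≡ ((1 + g) * k * q) * ((1 + g) * k * q) * (b * E + M)
      arrange₂ = solve-∀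
      arrange₃ : ∀ g N A m → (g * N) * (g * N) * (A * A * g * (2 * m) + A * A * m) + m * (A * A) * (N * N) * g * (3 * g + 2)
        ≡ A * A * g * ((1 + g) * (1 + g)) * (N * N) * (2 * m)
      arrange₃ = solve-∀

    -- A good sample is blown up and compared with `Q`. A bad one gets the trivial bound `N ^ s`,
    -- and the last factor is then at least 1: the clique count itself serves as a bound for the
    -- indicator, which builds Markov's inequality into the average.
    sample-bound : ∀ φ → length φ ≡ k → q ^ s * hom G s φ ≤ Q + N ^ s * (hom G ρ φ + 𝟙dense G V k b φ)
    sample-bound φ len = by-cases (hom G ρ φ) refl (𝟙?-cases (dense? G V k b φ))
      where
      open ≤-Reasoning
      trivial : ∀ x → 1 ≤ x → q ^ s * hom G s φ ≤ Q + N ^ s * x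
      trivial x 1≤x = begin
        q ^ s * hom G s φ      ≤⟨ *-monoʳ-≤ (q ^ s) (≤-trans (hom≤^ G s φ) (≤-reflexive (cong (_^ s) len))) ⟩
        q ^ s * k ^ s          ≡⟨ sym (^-distribʳ-* q k s) ⟩
        (q * k) ^ s            ≤⟨ ^-monoˡ-≤ s qk≤N ⟩
        N ^ s                  ≤⟨ m≤m*n (N ^ s) x {{>-nonZero 1≤x}} ⟩
        N ^ s * x              ≤⟨ m≤n+m _ Q ⟩
        Q + N ^ s * x          ∎
      by-cases : ∀ h → hom G ρ φ ≡ h → (𝟙dense G V k b φ ≡ 1 × Dense G V k b φ) ⊎ (𝟙dense G V k b φ ≡ 0 × ¬ Dense G V k b φ) →
        q ^ s * hom G s φ ≤ Q + N ^ s * (hom G ρ φ + 𝟙dense G V k b φ)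
      by-cases (suc h) eq _                   = trivial _ (≤-trans (≤-trans (s≤s z≤n) (≤-reflexive (sym eq))) (m≤m+n _ _))
      by-cases zero    eq (inj₁ (eq′ , _))    = trivial _ (≤-trans (≤-reflexive (sym eq′)) (m≤n+m _ _))
      by-cases zero    eq (inj₂ (_ , ¬dense)) = begin
        q ^ s * hom G s φ      ≡⟨ sym (∑^-copies s q φ (cl G)) ⟩
        hom G s (copies q φ)   ≤⟨ extremal (copies q φ)
                                    (trans (∑^-copies ρ q φ (cl G)) (trans (cong (q ^ ρ *_) eq) (*-zeroʳ (q ^ ρ))))
                                    (≤-trans (≤-reflexive (∑^-copies 2 q φ (cl G))) (few-edges φ ¬dense)) ⟩
        Q                      ≤⟨ m≤m+n Q _ ⟩
        Q + N ^ s * (hom G ρ φ + 𝟙dense G V k b φ) ∎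

    few-cliques-sampled : C * ∑^ k V (hom G ρ) ≤ N ^ k
    few-cliques-sampled = cancel-≤ {N ^ ρ} (1≤^ ρ 1≤N) (begin
      N ^ ρ * (C * ∑^ k V (hom G ρ))                    ≡⟨ arrange₁ (N ^ ρ) C _ ⟩
      C * (N ^ ρ * ∑^ k V (hom G ρ))                    ≡⟨ cong (λ z → C * (N ^ ρ * z)) (∑^-cong k V λ φ _ → hom≡∑inj G ρ φ) ⟩
      C * (N ^ ρ * ∑^ k V (λ φ → ∑inj ρ φ (cl G)))      ≡⟨ cong (C *_) (∑^-∑inj k ρ V (cl G)) ⟩
      C * (falling k ρ * (N ^ k * hom G ρ V))           ≤⟨ *-monoʳ-≤ C (*-monoˡ-≤ _ (falling≤^ k ρ)) ⟩
      C * (k ^ ρ * (N ^ k * hom G ρ V))                 ≡⟨ arrange₂ C (k ^ ρ) (N ^ k) _ ⟩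
      N ^ k * (C * k ^ ρ * hom G ρ V)                   ≤⟨ *-monoʳ-≤ (N ^ k) few-cliques ⟩
      N ^ k * N ^ ρ                                     ≡⟨ *-comm (N ^ k) _ ⟩
      N ^ ρ * N ^ k                                     ∎)
      where
      open ≤-Reasoning
      arrange₁ : ∀ x y z → x * (y * z) ≡ y * (x * z)
      arrange₁ = solve-∀
      arrange₂ : ∀ x y z w → x * (y * (z * w)) ≡ z * (x * y * w)
      arrange₂ = solve-∀

    averaged : C * (q ^ s * falling k s) * hom G s V ≤ N ^ s * (C * Q + 2 * N ^ s)
    averaged = cancel-≤ {N ^ k} (1≤^ k 1≤N) (begin
      N ^ k * (C * (q ^ s * falling k s) * hom G s V)
        ≡⟨ arrange₁ (N ^ k) C (q ^ s) (falling k s) (hom G s V) ⟩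
      C * q ^ s * (falling k s * (N ^ k * hom G s V))
        ≡⟨ cong (C * q ^ s *_) (sym (∑^-∑inj k s V (cl G))) ⟩
      C * q ^ s * (N ^ s * ∑^ k V (λ φ → ∑inj s φ (cl G)))
        ≡⟨ cong (λ z → C * q ^ s * (N ^ s * z)) (∑^-cong k V λ φ _ → sym (hom≡∑inj G s φ)) ⟩
      C * q ^ s * (N ^ s * ∑^ k V (hom G s))
        ≡⟨ arrange₂ C (q ^ s) (N ^ s) _ ⟩
      N ^ s * C * (q ^ s * ∑^ k V (hom G s))
        ≡⟨ cong (N ^ s * C *_) (sym (∑^-*ˡ (q ^ s) k V (hom G s))) ⟩
      N ^ s * C * ∑^ k V (λ φ → q ^ s * hom G s φ)
        ≤⟨ *-monoʳ-≤ (N ^ s * C) (∑^-mono k V sample-bound) ⟩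
      N ^ s * C * ∑^ k V (λ φ → Q + N ^ s * (hom G ρ φ + d φ))
        ≡⟨ cong (N ^ s * C *_) (trans (∑^-+ k V (λ _ → Q) (λ φ → N ^ s * (hom G ρ φ + d φ))) (cong₂ _+_ (∑^-const k V Q)
             (trans (∑^-*ˡ (N ^ s) k V (λ φ → hom G ρ φ + d φ)) (cong (N ^ s *_) (∑^-+ k V (hom G ρ) d))))) ⟩
      N ^ s * C * (N ^ k * Q + N ^ s * (∑^ k V (hom G ρ) + ∑^ k V d))
        ≡⟨ arrange₃ (N ^ s) C (N ^ k) Q _ _ ⟩
      N ^ s * (N ^ k * (C * Q)) + N ^ s * N ^ s * (C * ∑^ k V (hom G ρ) + C * ∑^ k V d)
        ≤⟨ +-monoʳ-≤ (N ^ s * (N ^ k * (C * Q))) (*-monoʳ-≤ (N ^ s * N ^ s) (+-mono-≤ few-cliques-sampled few-dense)) ⟩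
      N ^ s * (N ^ k * (C * Q)) + N ^ s * N ^ s * (N ^ k + N ^ k)
        ≡⟨ arrange₄ (N ^ s) (N ^ k) (C * Q) ⟩
      N ^ k * (N ^ s * (C * Q + 2 * N ^ s)) ∎)
      where
      open ≤-Reasoning
      d = 𝟙dense G V k b
      arrange₁ : ∀ x c y f h → x * (c * (y * f) * h) ≡ c * y * (f * (x * h))
      arrange₁ = solve-∀
      arrange₂ : ∀ c x y z → c * x * (y * z) ≡ y * c * (x * z)
      arrange₂ = solve-∀
      arrange₃ : ∀ x c y q h d → x * c * (y * q + x * (h + d)) ≡ x * (y * (c * q)) + x * x * (c * h + c * d)
      arrange₃ = solve-∀
      arrange₄ : ∀ x y z → x * (y * z) + x * x * (y + y) ≡ y * (x * (z + 2 * x))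
      arrange₄ = solve-∀

    -- Three losses of at most N each against gN: from g to 1 + g, from rounding `q` down, and from
    -- the `s` used positions. Hence g = 3C.
    near : g * s ≤ k → (1 + g) * k ≤ N → ∀ k′ → k ≤ k′ + s → C * N ≤ C * (q * k′) + N
    near gs≤k gk≤N k′ k≤k′+s = cancel-≤ {3} (s≤s z≤n) (begin
      3 * (C * N)                                   ≡⟨ sym (*-assoc 3 C N) ⟩
      g * N                                         ≤⟨ q-hi ⟩
      (1 + g) * k * suc q                           ≡⟨ arrange₁ g k q ⟩
      g * (q * k) + q * k + (1 + g) * k             ≤⟨ +-mono-≤ (+-mono-≤ (*-monoʳ-≤ g (*-monoʳ-≤ q k≤k′+s)) qk≤N) gk≤N ⟩
      g * (q * (k′ + s)) + N + N                    ≡⟨ arrange₂ g q k′ s N ⟩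
      g * (q * k′) + q * (g * s) + (N + N)          ≤⟨ +-monoˡ-≤ (N + N) (+-monoʳ-≤ (g * (q * k′)) (≤-trans (*-monoʳ-≤ q gs≤k) qk≤N)) ⟩
      g * (q * k′) + N + (N + N)                    ≡⟨ arrange₃ C (q * k′) N ⟩
      3 * (C * (q * k′) + N)                        ∎)
      where
      open ≤-Reasoning
      arrange₁ : ∀ g k q → (1 + g) * k * (1 + q) ≡ g * (q * k) + q * k + (1 + g) * k
      arrange₁ = solve-∀
      arrange₂ : ∀ g q k s N → g * (q * (k + s)) + N + N ≡ g * (q * k) + q * (g * s) + (N + N)
      arrange₂ = solve-∀
      arrange₃ : ∀ C x N → 3 * C * x + N + (N + N) ≡ 3 * (C * x + N)
      arrange₃ = solve-∀

    -- In the error `2 + s`, the 2 stems from the two kinds of bad samples in `averaged` and the `s`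
    -- from `bernoulli`.
    sampled : g * s ≤ k → (1 + g) * k ≤ N → C * hom G s V ≤ C * Q + (2 + s) * N ^ s
    sampled gs≤k gk≤N = cancel-≤ {N ^ s} (1≤^ s 1≤N) (begin
      N ^ s * (C * h)
        ≡⟨ arrange₁ (N ^ s) C h ⟩
      C * N ^ s * h
        ≤⟨ *-monoˡ-≤ h (bernoulli C q N k s qk≤N (near gs≤k gk≤N)) ⟩
      (C * (q ^ s * falling k s) + s * N ^ s) * h
        ≡⟨ *-distribʳ-+ h (C * (q ^ s * falling k s)) (s * N ^ s) ⟩
      C * (q ^ s * falling k s) * h + s * N ^ s * h
        ≤⟨ +-mono-≤ averaged (*-monoʳ-≤ (s * N ^ s) (hom≤^ G s V)) ⟩
      N ^ s * (C * Q + 2 * N ^ s) + s * N ^ s * N ^ s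
        ≡⟨ arrange₂ (N ^ s) (C * Q) s ⟩
      N ^ s * (C * Q + (2 + s) * N ^ s) ∎)
      where
      open ≤-Reasoning
      h = hom G s V
      arrange₁ : ∀ x y z → x * (y * z) ≡ y * x * z
      arrange₁ = solve-∀
      arrange₂ : ∀ x y s → x * (y + 2 * x) + s * x * x ≡ x * (y + (2 + s) * x)
      arrange₂ = solve-∀

module _ (ρ s A D : ℕ) (1≤s : 1 ≤ s) (1≤A : 1 ≤ A) (1≤D : 1 ≤ D) where

  -- 1/C bounds each relative loss; g controls the rounding of the blowup factor q, b the admissible
  -- deviation of the edge density, and k makes deviating samples and repeated positions rare.
  private
    C g b k : ℕ
    C = D * (3 + s)
    g = 3 * C
    b = A * A * g
    k = 18 * (b * b) * (C * (3 * s))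

    1≤C : 1 ≤ C
    1≤C = *-mono-≤ 1≤D (s≤s z≤n)
    1≤b : 1 ≤ b
    1≤b = *-mono-≤ (*-mono-≤ 1≤A 1≤A) (≤-trans 1≤C (m≤n*m C 3))
    1≤18b² : 1 ≤ 18 * (b * b)
    1≤18b² = *-mono-≤ (s≤s (z≤n {17})) (*-mono-≤ 1≤b 1≤b)
    1≤3s : 1 ≤ 3 * s
    1≤3s = ≤-trans 1≤s (m≤n*m s 3)
    1≤k : 1 ≤ k
    1≤k = *-mono-≤ 1≤18b² (*-mono-≤ 1≤C 1≤3s)

  -- A reciprocal density: below 1/(C k^ρ), a sample of length `k` has on average at most 1/C
  -- ordered copies of K_ρ.
  sparsity : ℕ
  sparsity = C * k ^ ρ

  threshold : ℕ
  threshold = suc ((1 + g) * k)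

  -- `sampled` loses (2 + s)/C, and C = D(3 + s) keeps this below 1/D. The strictness is what later
  -- contradicts `many-cliques`.
  sparse⇒few-cliques : (G : Graph) (V : List (Fin (n G))) (m Q : ℕ) → threshold ≤ length V →
    hom G 2 V ≤ 2 * m → length V * length V ≤ A * A * m →
    sparsity * hom G ρ V ≤ length V ^ ρ →
    (∀ L → hom G ρ L ≡ 0 → hom G 2 L ≤ 2 * m → hom G s L ≤ Q) →
    D * hom G s V < D * Q + length V ^ s
  sparse⇒few-cliques G V m Q N-large E≤ N²≤ few-cliques extremal =
    *-cancelˡ-< (3 + s) _ _ (begin-strict
      (3 + s) * (D * hom G s V)               ≡⟨ arrange₁ s D (hom G s V) ⟩
      C * hom G s V                           ≤⟨ sampled G V ρ s C A m Q k q 1≤A 1≤C 1≤k 1≤N E≤ N²≤ q-lo q-hi few-dense few-cliques extremal gs≤k gk≤N ⟩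
      C * Q + (2 + s) * N ^ s                 <⟨ +-monoʳ-< (C * Q) (m<n+m ((2 + s) * N ^ s) (1≤^ s 1≤N)) ⟩
      C * Q + (3 + s) * N ^ s                 ≡⟨ arrange₂ s D Q (N ^ s) ⟩
      (3 + s) * (D * Q + N ^ s)               ∎)
    where
    open ≤-Reasoning
    N = length V
    1≤N : 1 ≤ N
    1≤N = ≤-trans (s≤s z≤n) N-large
    gk≤N : (1 + g) * k ≤ N
    gk≤N = ≤-trans (n≤1+n _) N-large
    division = divide (g * N) ((1 + g) * k) (*-mono-≤ (s≤s (z≤n {g})) 1≤k)
    q = proj₁ division
    q-lo = proj₁ (proj₂ division)
    q-hi = proj₂ (proj₂ division)
    arrange₀ : ∀ C s → 3 * C * s ≡ 1 * (C * (3 * s))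
    arrange₀ = solve-∀
    gs≤k : g * s ≤ k
    gs≤k = ≤-trans (≤-reflexive (arrange₀ C s)) (*-monoˡ-≤ (C * (3 * s)) 1≤18b²)
    few-dense : C * ∑^ k V (𝟙dense G V k b) ≤ N ^ k
    few-dense = cancel-≤ 1≤18b² (begin
      18 * (b * b) * (C * S)               ≤⟨ *-monoʳ-≤ (18 * (b * b)) (*-monoˡ-≤ S (m≤m*n C (3 * s) {{>-nonZero 1≤3s}})) ⟩
      18 * (b * b) * (C * (3 * s) * S)     ≡⟨ sym (*-assoc (18 * (b * b)) _ S) ⟩
      k * S                                ≤⟨ chebyshev G V k b 1≤N 1≤k ⟩
      18 * (b * b) * N ^ k                 ∎)
      where
      S = ∑^ k V (𝟙dense G V k b)
    arrange₁ : ∀ s D h → (3 + s) * (D * h) ≡ D * (3 + s) * h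
    arrange₁ = solve-∀
    arrange₂ : ∀ s D Q p → D * (3 + s) * Q + (3 + s) * p ≡ (3 + s) * (D * Q + p)
    arrange₂ = solve-∀

-- Pulled-back graphs and padding to m edges

∈⇒≤∑ : {V : List A} {x : A} → x ∈ V → (f : A → ℕ) → f x ≤ ∑ V f
∈⇒≤∑ (here refl) f = m≤m+n _ _
∈⇒≤∑ (there x∈V) f = ≤-trans (∈⇒≤∑ x∈V f) (m≤n+m _ _)

tabulate≤∑^ : ∀ {l} {V : List A} (f : Fin l → A) → (∀ i → f i ∈ V) → ∀ F → F (tabulate f) ≤ ∑^ l V F
tabulate≤∑^ {l = zero}  f f∈V F = ≤-refl
tabulate≤∑^ {l = suc l} {V} f f∈V F = ≤-trans
  (tabulate≤∑^ (f ∘ suc) (f∈V ∘ suc) (F ∘ (f zero ∷_)))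
  (∈⇒≤∑ (f∈V zero) (λ x → ∑^ l V (F ∘ (x ∷_))))

1≤! : ∀ k → 1 ≤ k !
1≤! k = n≢0⇒n>0 (≢-nonZero⁻¹ (k !) {{k !≢0}})

κ≡0⇒Free : ∀ ρ H → κ ρ H ≡ 0 → Free (complete ρ) H
κ≡0⇒Free ρ H κ≡0 (f , _ , adj-f) = contradiction (≤-trans 1≤hom (≤-reflexive hom≡0)) λ ()
  where
  hom≡0 : hom H ρ (allFin (n H)) ≡ 0
  hom≡0 = trans (hom-allFin H ρ) (trans (cong (ρ ! *_) κ≡0) (*-zeroʳ (ρ !)))
  1≤hom : 1 ≤ hom H ρ (allFin (n H))
  1≤hom = ≤-trans
    (≤-reflexive (sym (cong 𝟙 (clique-tabulate⁺ H f λ i j i≢j → adj-f i j (complete-adj⁺ i j i≢j)))))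
    (tabulate≤∑^ f (λ i → ∈-allFin (f i)) (cl H))

all-map : (p : A → Bool) (f : B → A) → ∀ xs → all p (map f xs) ≡ all (p ∘ f) xs
all-map p f []       = refl
all-map p f (x ∷ xs) = cong (p (f x) ∧_) (all-map p f xs)

-- `f` need not be injective: vertices with the same image are nonadjacent twins by `irrefl`, so
-- `pull G (lookup L)` realises the blowup encoded by `L`.
pull : (G : Graph) {k : ℕ} → (Fin k → Fin (n G)) → Graph
pull G {k} f = record
  { n      = k
  ; adj    = λ i j → adj G (f i) (f j)
  ; sym    = λ i j → Graph.sym G (f i) (f j)
  ; irrefl = λ i → irrefl G (f i)
  }

clique-pull : ∀ G {k} (f : Fin k → Fin (n G)) c → isCliqueB (pull G f) c ≡ isCliqueB G (map f c)
clique-pull G f []      = refl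
clique-pull G f (x ∷ c) = cong₂ _∧_ (sym (all-map (adj G (f x)) f c)) (clique-pull G f c)

κ-pull : ∀ G L s → s ! * κ s (pull G (lookup L)) ≡ hom G s L
κ-pull G L s = begin
  s ! * κ s (pull G (lookup L))                            ≡⟨ sym (hom-allFin (pull G (lookup L)) s) ⟩
  hom (pull G (lookup L)) s (allFin (length L))            ≡⟨ ∑^-cong s (allFin (length L)) (λ c _ → cong 𝟙 (clique-pull G (lookup L) c)) ⟩
  ∑^ s (allFin (length L)) (cl G ∘ map (lookup L))         ≡⟨ sym (∑^-map s (lookup L) (allFin (length L)) (cl G)) ⟩
  hom G s (map (lookup L) (allFin (length L)))             ≡⟨ cong (hom G s) (trans (map-tabulate id (lookup L)) (tabulate-lookup L)) ⟩
  hom G s L                                                ∎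
  where open ≡-Reasoning

attach : (H : Graph) → (Fin (n H) → Bool) → Graph
attach H N = record { n = suc (n H) ; adj = adj′ ; sym = sym′ ; irrefl = irrefl′ }
  where
  adj′ : Fin (suc (n H)) → Fin (suc (n H)) → Bool
  adj′ zero    zero    = false
  adj′ zero    (suc j) = N j
  adj′ (suc i) zero    = N i
  adj′ (suc i) (suc j) = adj H i j
  sym′ : ∀ i j → adj′ i j ≡ adj′ j i
  sym′ zero    zero    = refl
  sym′ zero    (suc j) = refl
  sym′ (suc i) zero    = refl
  sym′ (suc i) (suc j) = Graph.sym H i j
  irrefl′ : ∀ i → adj′ i i ≡ false
  irrefl′ zero    = refl
  irrefl′ (suc i) = irrefl H i

∑sub-zero : ∀ s (V : List A) {F : List A → ℕ} → (∀ c → length c ≡ s → F c ≡ 0) → ∑sub s V F ≡ 0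
∑sub-zero s V F≡0 = trans (∑sub-cong s V F≡0) (∑-zero (subsetsOf s V))

∑sub-1 : (V : List A) (F : List A → ℕ) → ∑sub 1 V F ≡ ∑ V (λ x → F (x ∷ []))
∑sub-1 []      F = refl
∑sub-1 (x ∷ V) F = cong (F (x ∷ []) +_) (∑sub-1 V F)

module _ (H : Graph) (N : Fin (n H) → Bool) where

  clique-suc : ∀ c → isCliqueB (attach H N) (map suc c) ≡ isCliqueB H c
  clique-suc []      = refl
  clique-suc (x ∷ c) = cong₂ _∧_ (all-map (adj (attach H N) (suc x)) suc c) (clique-suc c)

  κ-attach : ∀ i → κ (suc i) (attach H N) ≡ ∑sub i (allFin (n H)) (λ c → 𝟙 (all N c ∧ isCliqueB H c)) + κ (suc i) H
  κ-attach i = begin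
    ∑sub (suc i) (zero ∷ tabulate suc) F
      ≡⟨ cong (λ V → ∑sub (suc i) (zero ∷ V) F) (sym (map-tabulate id suc)) ⟩
    ∑sub (suc i) (zero ∷ map suc (allFin (n H))) F
      ≡⟨ ∑sub-∷ i zero (map suc (allFin (n H))) F ⟩
    ∑sub i (map suc (allFin (n H))) (F ∘ (zero ∷_)) + ∑sub (suc i) (map suc (allFin (n H))) F
      ≡⟨ cong₂ _+_ (∑sub-map i suc (allFin (n H)) _) (∑sub-map (suc i) suc (allFin (n H)) F) ⟩
    ∑sub i (allFin (n H)) (F ∘ (zero ∷_) ∘ map suc) + ∑sub (suc i) (allFin (n H)) (F ∘ map suc)
      ≡⟨ cong₂ _+_ (∑sub-cong i (allFin (n H)) λ c _ → cong 𝟙 (cong₂ _∧_ (all-map (adj (attach H N) zero) suc c) (clique-suc c)))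
                   (∑sub-cong (suc i) (allFin (n H)) λ c _ → cong 𝟙 (clique-suc c)) ⟩
    ∑sub i (allFin (n H)) (λ c → 𝟙 (all N c ∧ isCliqueB H c)) + κ (suc i) H ∎
    where
    open ≡-Reasoning
    F = cl (attach H N)

  edges-attach : edges (attach H N) ≡ ∑ (allFin (n H)) (𝟙 ∘ N) + edges H
  edges-attach = trans (κ-attach 1) (cong (_+ edges H) (trans (∑sub-1 (allFin (n H)) _)
    (∑-cong (allFin (n H)) λ x → cong 𝟙 (trans (∧-identityʳ (N x ∧ true)) (∧-identityʳ (N x))))))

  -- A clique of at least three vertices through the new vertex would contain two adjacent, hence
  -- distinct, neighbours of it.
  κ-attach-pendant : (∀ x y → N x ≡ true → N y ≡ true → x ≡ y) → ∀ i → κ (3 + i) (attach H N) ≡ κ (3 + i) H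
  κ-attach-pendant unique i = trans (κ-attach (2 + i)) (cong (_+ κ (3 + i) H) (∑sub-zero (2 + i) (allFin (n H)) no-clique))
    where
    no-clique : ∀ c → length c ≡ 2 + i → 𝟙 (all N c ∧ isCliqueB H c) ≡ 0
    no-clique (x ∷ y ∷ c) _ with N x in Nx | N y in Ny
    ... | false | _     = refl
    ... | true  | false = refl
    ... | true  | true with refl ← unique x y Nx Ny rewrite irrefl H x = cong 𝟙 (∧-zeroʳ (all N c))

leaf : ∀ {k} → Fin (suc k) → Bool
leaf zero    = true
leaf (suc _) = false

leaf-unique : ∀ {k} (x y : Fin (suc k)) → leaf x ≡ true → leaf y ≡ true → x ≡ y
leaf-unique zero zero _ _ = refl

∑-leaf : ∀ k → ∑ (allFin (suc k)) (𝟙 ∘ leaf) ≡ 1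
∑-leaf k = cong suc (trans (cong (λ V → ∑ V (𝟙 ∘ leaf {k})) (sym (map-tabulate id suc)))
  (trans (∑-map suc (allFin k) (𝟙 ∘ leaf {k})) (∑-zero (allFin k))))

-- `leaf` selects the vertex attached last, so the added edges form a path.
add-pendants : ∀ d H N → ∃[ K ] (edges K ≡ d + edges (attach H N) × (∀ i → κ (3 + i) K ≡ κ (3 + i) (attach H N)))
add-pendants zero    H N = attach H N , refl , λ i → refl
add-pendants (suc d) H N =
  let K , edges-K , κ-K = add-pendants d (attach H N) leaf
  in K
   , trans edges-K (trans (cong (d +_) (trans (edges-attach (attach H N) leaf) (cong (_+ edges (attach H N)) (∑-leaf (n H)))))
       (+-suc d (edges (attach H N))))
   , λ i → trans (κ-K i) (κ-attach-pendant (attach H N) leaf leaf-unique i)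

pad-edges : ∀ H m → edges H ≤ m → ∃[ K ] (edges K ≡ m × (∀ i → κ (3 + i) K ≡ κ (3 + i) H))
pad-edges H m e≤m =
  -- The path starts at a new isolated vertex, as `H` may have no vertices.
  let K , edges-K , κ-K = add-pendants (m ∸ edges H) H (λ _ → false)
  in K
   , trans edges-K (trans (cong (m ∸ edges H +_) (trans (edges-attach H (λ _ → false)) (cong (_+ edges H) (∑-zero (allFin (n H))))))
       (m∸n+n≡m e≤m))
   , λ i → trans (κ-K i) (κ-attach-pendant H (λ _ → false) (λ _ _ ()) i)

-- `IsMexK` speaks of exactly `m` edges, whereas a blown-up sample has at most `m`; padding bridges
-- the gap without touching cliques of size 3 or more.
mex-bound : ∀ ρ s m M → IsMexK (3 + s) (complete (3 + ρ)) m M → ∀ G L →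
  hom G (3 + ρ) L ≡ 0 → hom G 2 L ≤ 2 * m → hom G (3 + s) L ≤ (3 + s) ! * M
mex-bound ρ s m M (_ , maximal) G L hom≡0 hom≤2m =
  let K , edges-K , κ-K = pad-edges H m edges≤m
  in begin
    hom G (3 + s) L             ≡⟨ sym (κ-pull G L (3 + s)) ⟩
    (3 + s) ! * κ (3 + s) H     ≡⟨ cong ((3 + s) ! *_) (sym (κ-K s)) ⟩
    (3 + s) ! * κ (3 + s) K     ≤⟨ *-monoʳ-≤ ((3 + s) !) (maximal K (κ≡0⇒Free (3 + ρ) K (trans (κ-K ρ) κ≡0)) edges-K) ⟩
    (3 + s) ! * M               ∎
  where
  open ≤-Reasoning
  H = pull G (lookup L)
  edges≤m : edges H ≤ m
  edges≤m = cancel-≤ {2} (s≤s z≤n) (≤-trans (≤-reflexive (κ-pull G L 2)) hom≤2m)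
  κ≡0 : κ (3 + ρ) H ≡ 0
  κ≡0 = n≤0⇒n≡0 (cancel-≤ (1≤! (3 + ρ)) (≤-reflexive (trans (trans (κ-pull G L (3 + ρ)) hom≡0) (sym (*-zeroʳ ((3 + ρ) !))))))

-- Restriction to vertices of high degree

^-cancel-≤ : ∀ k {x y} → x ^ suc k ≤ y ^ suc k → x ≤ y
^-cancel-≤ k x^≤y^ = ≮⇒≥ λ y<x → <⇒≱ (^-monoˡ-< (suc k) y<x) x^≤y^

floor-sqrt : ∀ m → ∃[ w ] (w ^ 2 ≤ m × m < suc w ^ 2)
floor-sqrt zero    = 0 , z≤n , s≤s z≤n
floor-sqrt (suc m) with floor-sqrt m
... | w , lo , hi with suc w ^ 2 ≤? suc m
...   | yes lo′ = suc w , lo′ , ≤-<-trans hi (^-monoˡ-< 2 (n<1+n (suc w)))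
...   | no  hi′ = w , m≤n⇒m≤1+n lo , ≰⇒> hi′

in?≤1 : {A : Set} {P : Pred A 0ℓ} (P? : Decidable P) → ∀ x → in? P? x ≤ 1
in?≤1 P? x with P? x
... | yes _ = ≤-refl
... | no  _ = z≤n

hom-filter≤hom : ∀ G {P : Pred (Fin (n G)) 0ℓ} (P? : Decidable P) s L → hom G s (filter P? L) ≤ hom G s L
hom-filter≤hom G P? s L = begin
  hom G s (filter P? L)                                  ≡⟨ sym (∑^-filter P? s L (cl G)) ⟩
  ∑^ s L (λ c → product (map (in? P?) c) * cl G c)       ≤⟨ ∑^-mono s L (λ c _ → *-monoˡ-≤ (cl G c) (product≤1 (in? P?) (in?≤1 P?) c)) ⟩
  ∑^ s L (λ c → 1 * cl G c)                              ≡⟨ ∑^-cong s L (λ c _ → *-identityˡ (cl G c)) ⟩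
  hom G s L                                              ∎
  where open ≤-Reasoning

module HighDegree (G : Graph) (α w : ℕ) where

  private
    V = allFin (n G)
    m = edges G

  deg : Fin (n G) → ℕ
  deg x = ∑ V (𝟙adj G x)

  High : Pred (Fin (n G)) 0ℓ
  High x = w < α * deg x

  high? : Decidable High
  high? x = w <? α * deg x

  core : List (Fin (n G))
  core = filter high? V

  ∑-deg : ∑ V deg ≡ 2 * m
  ∑-deg = trans (∑-cong V λ x → ∑-cong V λ y → cong 𝟙 (sym (trans (∧-identityʳ (adj G x y ∧ true)) (∧-identityʳ (adj G x y)))))
                (hom-allFin G 2)

  hom₂-core≤ : hom G 2 core ≤ 2 * m
  hom₂-core≤ = ≤-trans (hom-filter≤hom G high? 2 V) (≤-reflexive (hom-allFin G 2))

  core-size : length core * w ≤ α * (2 * m)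
  core-size = begin
    length core * w               ≡⟨ sym (∑-const core w) ⟩
    ∑ core (λ _ → w)              ≡⟨ sym (∑-filter high? V (λ _ → w)) ⟩
    ∑ V (λ x → in? high? x * w)   ≤⟨ ∑-mono V high-degree ⟩
    ∑ V (λ x → α * deg x)         ≡⟨ trans (∑-*ˡ α V deg) (cong (α *_) ∑-deg) ⟩
    α * (2 * m)                   ∎
    where
    open ≤-Reasoning
    high-degree : ∀ x → in? high? x * w ≤ α * deg x
    high-degree x = by-cases (high? x)
      where
      by-cases : (d : Dec (High x)) → (if does d then 1 else 0) * w ≤ α * deg x
      by-cases (yes w<) = ≤-trans (≤-reflexive (+-identityʳ w)) (<⇒≤ w<)
      by-cases (no _)   = z≤n

  -- For a rejected vertex, α deg ≤ w. Of its 2 + s factors deg, one absorbs `α`, `s` are bounded by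
  -- `w`, and one is kept for the degree sum 2m. A gain of a single factor `α` is enough.
  low-degree-cliques : ∀ s → 1 ≤ α → α * hom G (3 + s) V ≤ α * hom G (3 + s) core + (3 + s) * (w ^ (1 + s) * (2 * m))
  low-degree-cliques s 1≤α = begin
    α * hom G (3 + s) V
      ≤⟨ *-monoʳ-≤ α (hom-filter G high? (2 + s) V) ⟩
    α * (hom G (3 + s) core + (3 + s) * S)
      ≡⟨ arrange α _ (3 + s) S ⟩
    α * hom G (3 + s) core + (3 + s) * (α * S)
      ≤⟨ +-monoʳ-≤ (α * hom G (3 + s) core) (*-monoʳ-≤ (3 + s) low) ⟩
    α * hom G (3 + s) core + (3 + s) * (w ^ (1 + s) * (2 * m)) ∎
    where
    open ≤-Reasoning
    S = ∑ V (λ x → out? high? x * deg x ^ (2 + s))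
    arrange : ∀ x y z t → x * (y + z * t) ≡ x * y + z * (x * t)
    arrange = solve-∀
    arrange′ : ∀ α d p → α * (1 * (d * (d * p))) ≡ α * d * p * d
    arrange′ = solve-∀
    low-degree : ∀ x → α * (out? high? x * deg x ^ (2 + s)) ≤ w ^ (1 + s) * deg x
    low-degree x = by-cases (high? x)
      where
      by-cases : (d : Dec (High x)) → α * ((if does d then 0 else 1) * deg x ^ (2 + s)) ≤ w ^ (1 + s) * deg x
      by-cases (yes _) = ≤-trans (≤-reflexive (*-zeroʳ α)) z≤n
      by-cases (no ≮)  = ≤-trans (≤-reflexive (arrange′ α (deg x) (deg x ^ s)))
        (*-monoˡ-≤ (deg x) (*-mono-≤ αd≤w (^-monoˡ-≤ s (≤-trans (m≤n*m (deg x) α {{>-nonZero 1≤α}}) αd≤w))))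
        where
        αd≤w : α * deg x ≤ w
        αd≤w = ≮⇒≥ ≮
    low : α * S ≤ w ^ (1 + s) * (2 * m)
    low = begin
      α * S                                            ≡⟨ sym (∑-*ˡ α V _) ⟩
      ∑ V (λ x → α * (out? high? x * deg x ^ (2 + s))) ≤⟨ ∑-mono V low-degree ⟩
      ∑ V (λ x → w ^ (1 + s) * deg x)                  ≡⟨ trans (∑-*ˡ (w ^ (1 + s)) V deg) (cong (w ^ (1 + s) *_) ∑-deg) ⟩
      w ^ (1 + s) * (2 * m)                            ∎

-- w = ⌊√m⌋.
module Core (s q α A N₀ F : ℕ) (1≤q : 1 ≤ q) (1≤α : 1 ≤ α) (α≡ : α ≡ 16 * ((3 + s) * q)) (A≡ : A ≡ 8 * α) (1≤F : 1 ≤ F)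
  (m w : ℕ) (w₀≤w : 1 + 2 * q * N₀ ≤ w) (w²≤m : w ^ 2 ≤ m) (m<[1+w]² : m < suc w ^ 2)
  (G : Graph) (edges≡m : edges G ≡ m) (M : ℕ) (hom≡ : hom G (3 + s) (allFin (n G)) ≡ F * κ (3 + s) G)
  (excess : q * M + w ^ (3 + s) ≤ q * κ (3 + s) G) where

  open HighDegree G α w
  private
    σ N h : ℕ
    σ = 3 + s
    N = length core
    h = hom G σ core

    1≤2q : 1 ≤ 2 * q
    1≤2q = ≤-trans 1≤q (m≤n*m q 2)

    1≤w : 1 ≤ w
    1≤w = ≤-trans (s≤s z≤n) w₀≤w

    m≤4w² : m ≤ 4 * (w * w)
    m≤4w² = begin
      m                      ≤⟨ <⇒≤ m<[1+w]² ⟩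
      (1 + w) ^ 2            ≤⟨ ^-monoˡ-≤ 2 (+-monoˡ-≤ w 1≤w) ⟩
      (w + w) ^ 2            ≡⟨ arrange w ⟩
      4 * (w * w)            ∎
      where
      open ≤-Reasoning
      arrange : ∀ w → (w + w) * ((w + w) * 1) ≡ 4 * (w * w)
      arrange = solve-∀

  -- Each vertex of `core` takes more than w/α of the degree sum 2m, and m ≤ 4w²; hence A = 8α.
  N≤Aw : N ≤ A * w
  N≤Aw = cancel-≤ 1≤w (begin
    w * N                        ≡⟨ *-comm w N ⟩
    N * w                        ≤⟨ core-size ⟩
    α * (2 * edges G)            ≡⟨ cong (λ e → α * (2 * e)) edges≡m ⟩
    α * (2 * m)                  ≤⟨ *-monoʳ-≤ α (*-monoʳ-≤ 2 m≤4w²) ⟩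
    α * (2 * (4 * (w * w)))      ≡⟨ trans (arrange α w) (cong (λ B → w * (B * w)) (sym A≡)) ⟩
    w * (A * w)                  ∎)
    where
    open ≤-Reasoning
    arrange : ∀ α w → α * (2 * (4 * (w * w))) ≡ w * (8 * α * w)
    arrange = solve-∀

  N²≤A²m : N * N ≤ A * A * m
  N²≤A²m = begin
    N * N                  ≤⟨ *-mono-≤ N≤Aw N≤Aw ⟩
    A * w * (A * w)        ≡⟨ arrange A w ⟩
    A * A * w ^ 2          ≤⟨ *-monoʳ-≤ (A * A) w²≤m ⟩
    A * A * m              ∎
    where
    open ≤-Reasoning
    arrange : ∀ A w → A * w * (A * w) ≡ A * A * (w * (w * 1))
    arrange = solve-∀

  -- On the scale 2q the excess is at least 2w^σ, and the low-degree vertices cost one w^σ of it: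
  -- their contribution is at most 8σw^σ by m ≤ 4w², against α = 8σ · 2q.
  excess-core : 2 * q * (F * M) + w ^ σ ≤ 2 * q * h
  excess-core = +-cancelʳ-≤ (w ^ σ) _ _ (begin
    2 * q * (F * M) + w ^ σ + w ^ σ
      ≤⟨ +-mono-≤ (+-monoʳ-≤ (2 * q * (F * M)) w^σ≤) w^σ≤ ⟩
    2 * q * (F * M) + F * w ^ σ + F * w ^ σ
      ≡⟨ arrange₁ q F M (w ^ σ) ⟩
    2 * (F * (q * M + w ^ σ))
      ≤⟨ *-monoʳ-≤ 2 (*-monoʳ-≤ F excess) ⟩
    2 * (F * (q * κ σ G))
      ≡⟨ arrange₂ F q (κ σ G) ⟩
    2 * q * (F * κ σ G)
      ≡⟨ cong (2 * q *_) (sym hom≡) ⟩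
    2 * q * hom G σ (allFin (n G))
      ≤⟨ cancel-≤ {8 * σ} (s≤s z≤n) scaled ⟩
    2 * q * h + w ^ σ ∎)
    where
    open ≤-Reasoning
    w^σ≤ : w ^ σ ≤ F * w ^ σ
    w^σ≤ = m≤n*m (w ^ σ) F {{>-nonZero 1≤F}}
    arrange₁ : ∀ q f M x → 2 * q * (f * M) + f * x + f * x ≡ 2 * (f * (q * M + x))
    arrange₁ = solve-∀
    arrange₂ : ∀ f q k → 2 * (f * (q * k)) ≡ 2 * q * (f * k)
    arrange₂ = solve-∀
    arrange₃ : ∀ σ q H → 8 * σ * (2 * q * H) ≡ 16 * (σ * q) * H
    arrange₃ = solve-∀
    arrange₄ : ∀ σ q h w p → 16 * (σ * q) * h + σ * (w * p * (2 * (4 * (w * w)))) ≡ 8 * σ * (2 * q * h + w * (w * (w * p)))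
    arrange₄ = solve-∀
    scaled : 8 * σ * (2 * q * hom G σ (allFin (n G))) ≤ 8 * σ * (2 * q * h + w ^ σ)
    scaled = begin
      8 * σ * (2 * q * hom G σ (allFin (n G)))             ≡⟨ trans (arrange₃ σ q _) (cong (_* hom G σ (allFin (n G))) (sym α≡)) ⟩
      α * hom G σ (allFin (n G))                           ≤⟨ low-degree-cliques s 1≤α ⟩
      α * h + σ * (w ^ (1 + s) * (2 * edges G))            ≡⟨ cong (λ e → α * h + σ * (w ^ (1 + s) * (2 * e))) edges≡m ⟩
      α * h + σ * (w ^ (1 + s) * (2 * m))                  ≤⟨ +-monoʳ-≤ (α * h) (*-monoʳ-≤ σ (*-monoʳ-≤ (w ^ (1 + s)) (*-monoʳ-≤ 2 m≤4w²))) ⟩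
      α * h + σ * (w ^ (1 + s) * (2 * (4 * (w * w))))      ≡⟨ trans (cong (λ β → β * h + σ * (w ^ (1 + s) * (2 * (4 * (w * w))))) α≡) (arrange₄ σ q h w (w ^ s)) ⟩
      8 * σ * (2 * q * h + w ^ σ)                          ∎

  -- The surviving excess forces `core` to be large, since N vertices carry at most N^σ ordered
  -- cliques: w^σ ≤ (2qN)^σ.
  N₀≤N : N₀ ≤ N
  N₀≤N = cancel-≤ 1≤2q (≤-trans (≤-trans (n≤1+n (2 * q * N₀)) w₀≤w) (^-cancel-≤ (2 + s) (begin
    w ^ σ                    ≤⟨ m≤n+m (w ^ σ) (2 * q * (F * M)) ⟩
    2 * q * (F * M) + w ^ σ ≤⟨ excess-core ⟩
    2 * q * h                ≤⟨ *-mono-≤ (m≤m*n (2 * q) ((2 * q) ^ (2 + s)) {{>-nonZero (1≤^ (2 + s) 1≤2q)}}) (hom≤^ G σ core) ⟩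
    (2 * q) ^ σ * N ^ σ      ≡⟨ sym (^-distribʳ-* (2 * q) N σ) ⟩
    (2 * q * N) ^ σ          ∎)))
    where open ≤-Reasoning

  -- By `N≤Aw`, the excess w^σ is at least N^σ/A^σ, a fixed share of all tuples of `core`.
  many-cliques : 2 * q * A ^ σ * (F * M) + N ^ σ ≤ 2 * q * A ^ σ * h
  many-cliques = begin
    2 * q * A ^ σ * (F * M) + N ^ σ
      ≤⟨ +-monoʳ-≤ (2 * q * A ^ σ * (F * M)) (≤-trans (^-monoˡ-≤ σ N≤Aw) (≤-reflexive (^-distribʳ-* A w σ))) ⟩
    2 * q * A ^ σ * (F * M) + A ^ σ * w ^ σ
      ≡⟨ arrange₁ (2 * q) (A ^ σ) (F * M) (w ^ σ) ⟩
    A ^ σ * (2 * q * (F * M) + w ^ σ)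
      ≤⟨ *-monoʳ-≤ (A ^ σ) excess-core ⟩
    A ^ σ * (2 * q * h)
      ≡⟨ arrange₂ (A ^ σ) (2 * q) h ⟩
    2 * q * A ^ σ * h ∎
    where
    open ≤-Reasoning
    arrange₁ : ∀ x y z v → x * y * z + y * v ≡ y * (x * z + v)
    arrange₁ = solve-∀
    arrange₂ : ∀ x y z → x * (y * z) ≡ y * x * z
    arrange₂ = solve-∀

-- The dichotomy between few and many K_{r+1}, and the theorem

sparse-or-blowup : ∀ ρ s t A D → 1 ≤ s → 1 ≤ A → 1 ≤ D → ∃[ N₀ ] (∀ G V m Q → Unique V → N₀ ≤ length V →
  hom G 2 V ≤ 2 * m → length V * length V ≤ A * A * m →
  (∀ L → hom G ρ L ≡ 0 → hom G 2 L ≤ 2 * m → hom G s L ≤ Q) →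
  D * hom G s V < D * Q + length V ^ s ⊎ Contains G (blowup (complete ρ) (suc t)))
sparse-or-blowup ρ s t A D 1≤s 1≤A 1≤D = N₁ + N₂ , λ G V m Q uniq N≥ E≤ N²≤ extremal →
  [ (λ many → inj₂ (proj₂ saturated G V uniq (≤-trans (m≤n+m N₂ N₁) N≥) many))
  , (λ few → inj₁ (sparse⇒few-cliques ρ s A D 1≤s 1≤A 1≤D G V m Q (≤-trans (m≤m+n N₁ N₂) N≥) E≤ N²≤ few extremal))
  ]′ (≤-total (length V ^ ρ) (Θ * hom G ρ V))
  where
  -- The sparsity demanded by sampling is the density handed to Erdős's theorem, so the two cases
  -- are exhaustive. It depends on no graph, which fixes both thresholds in advance.
  Θ = sparsity ρ s A D 1≤s 1≤A 1≤D
  saturated = supersaturation ρ t Θ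
  N₁ = threshold ρ s A D 1≤s 1≤A 1≤D
  N₂ = proj₁ saturated

-- With ε = p/q, the hypothesis `large` is the squared excess condition, which keeps exponents
-- integral for odd `s`. As p ≥ 1 and w² ≤ m, ε may be lowered to 1/q and √m to `w`.
excess-power : ∀ q p m w s → 1 ≤ p → w ^ 2 ≤ m → ∀ {M K} → M ≤ K → p ^ 2 * m ^ s ≤ (q * (K ∸ M)) ^ 2 → q * M + w ^ s ≤ q * K
excess-power q p m w s 1≤p w²≤m {M} {K} M≤K large = begin
  q * M + w ^ s              ≤⟨ +-monoʳ-≤ (q * M) (^-cancel-≤ 1 w^2s≤) ⟩
  q * M + q * (K ∸ M)        ≡⟨ sym (*-distribˡ-+ q M (K ∸ M)) ⟩
  q * (M + (K ∸ M))          ≡⟨ cong (q *_) (m+[n∸m]≡n M≤K) ⟩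
  q * K                      ∎
  where
  open ≤-Reasoning
  w^2s≤ : (w ^ s) ^ 2 ≤ (q * (K ∸ M)) ^ 2
  w^2s≤ = begin
    (w ^ s) ^ 2              ≡⟨ trans (^-*-assoc w s 2) (trans (cong (w ^_) (*-comm s 2)) (sym (^-*-assoc w 2 s))) ⟩
    (w ^ 2) ^ s              ≤⟨ ^-monoˡ-≤ s w²≤m ⟩
    m ^ s                    ≤⟨ m≤n*m (m ^ s) (p ^ 2) {{>-nonZero (1≤^ 2 1≤p)}} ⟩
    p ^ 2 * m ^ s            ≤⟨ large ⟩
    (q * (K ∸ M)) ^ 2        ∎

blowup-of-excess : ∀ ρ s t q α A → 1 ≤ q → 1 ≤ α → α ≡ 16 * ((3 + s) * q) → A ≡ 8 * α → ∃[ m₀ ] (∀ p m → 1 ≤ p → m₀ ≤ m →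
  ∀ M → IsMexK (3 + s) (complete (3 + ρ)) m M → ∀ G → edges G ≡ m → M ≤ κ (3 + s) G →
  p ^ 2 * m ^ (3 + s) ≤ (q * (κ (3 + s) G ∸ M)) ^ 2 → Contains G (blowup (complete (3 + ρ)) (suc t)))
blowup-of-excess ρ s t q α A 1≤q 1≤α α≡ A≡ = w₀ ^ 2 , contains
  where
  σ = 3 + s
  -- The precision at which the sparse outcome contradicts `many-cliques`.
  D = 2 * q * A ^ σ
  1≤A : 1 ≤ A
  1≤A = ≤-trans 1≤α (≤-trans (m≤n*m α 8) (≤-reflexive (sym A≡)))
  1≤D : 1 ≤ D
  1≤D = *-mono-≤ (≤-trans 1≤q (m≤n*m q 2)) (1≤^ σ 1≤A)
  dichotomy = sparse-or-blowup (3 + ρ) σ t A D (s≤s z≤n) 1≤A 1≤D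
  N₀ = proj₁ dichotomy
  w₀ = 1 + 2 * q * N₀
  contains : ∀ p m → 1 ≤ p → w₀ ^ 2 ≤ m → ∀ M → IsMexK σ (complete (3 + ρ)) m M → ∀ G → edges G ≡ m → M ≤ κ σ G →
    p ^ 2 * m ^ σ ≤ (q * (κ σ G ∸ M)) ^ 2 → Contains G (blowup (complete (3 + ρ)) (suc t))
  contains p m 1≤p m₀≤m M isMex G edges≡m M≤κ large =
    [ (λ few → contradiction many-cliques (<⇒≱ few)) , id ]′
      (proj₂ dichotomy G core m (σ ! * M) (filter⁺ high? (allFin⁺ (n G))) N₀≤N
        (≤-trans hom₂-core≤ (≤-reflexive (cong (2 *_) edges≡m))) N²≤A²m (mex-bound ρ s m M isMex G))
    where
    root = floor-sqrt m
    w = proj₁ root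
    w²≤m = proj₁ (proj₂ root)
    m<[1+w]² = proj₂ (proj₂ root)
    w₀≤w : w₀ ≤ w
    w₀≤w = ≮⇒≥ λ w<w₀ → <⇒≱ m<[1+w]² (≤-trans (^-monoˡ-≤ 2 w<w₀) m₀≤m)
    open HighDegree G α w
    open Core s q α A N₀ (σ !) 1≤q 1≤α α≡ A≡ (1≤! σ) m w w₀≤w w²≤m m<[1+w]² G edges≡m M (hom-allFin G σ)
      (excess-power q p m w σ 1≤p w²≤m M≤κ large)

1≤∣↥∣ : ∀ ε → Positive ε → 1 ≤ ∣ ↥ ε ∣
1≤∣↥∣ (mkℚ +[1+ _ ] _ _) _ = s≤s z≤n
1≤∣↥∣ (mkℚ +0       _ _) record { pos = () }
1≤∣↥∣ (mkℚ -[1+ _ ] _ _) record { pos = () }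

theorem1p9 : ∀ (r s t : ℕ) → 3 ≤ r → 3 ≤ s → 1 ≤ t →
    (ε : ℚ) → Positive ε →
    ∃[ m₀ ] (∀ (m : ℕ) → m₀ ≤ m →
    ∀ (M : ℕ) → IsMexK s (complete (suc r)) m M →
    ∀ (G : Graph) → edges G ≡ m →
    M ≤ κ s G →
    ∣ ↥ ε ∣ ^ 2 * m ^ s ≤ (↧ₙ ε * (κ s G ∸ M)) ^ 2 →
    Contains G (blowup (complete (suc r)) t))
theorem1p9 (suc (suc r)) (suc (suc (suc s))) (suc t) (s≤s (s≤s _)) (s≤s (s≤s (s≤s _))) (s≤s _) ε ε>0 =
  let q = ↧ₙ ε
      1≤α = *-mono-≤ (s≤s (z≤n {15})) (*-mono-≤ (s≤s (z≤n {2 + s})) (s≤s (z≤n {ℚ.denominator-1 ε})))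
      m₀ , blowup-in = blowup-of-excess r s t q (16 * ((3 + s) * q)) _ (s≤s z≤n) 1≤α refl refl
  in m₀ , λ m m₀≤m → blowup-in ∣ ↥ ε ∣ m (1≤∣↥∣ ε ε>0) m₀≤m
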